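{- Let $q$ be a prime power, $\mathbb{A}=\mathbb{F}_q[t]$, let $f\in\mathbb{A}$ be a non-constant polynomial of degree $n$, let $P\in\mathbb{A}$ be an irreducible polynomial of degree $d\ge1$, and let $e\ge 1$ be an integer. With the functions $B_k:\mathbb{A}_f\to\mathbb{A}_{P^e}$ ($k\ge 0$) defined in the context, a function $\sigma:\mathbb{A}_f\to\mathbb{A}_{P^e}$ is congruence preserving if and only if there is a unique sequence $\{c_0,c_1,\dots,c_{q^n-1}\}$ of elements of $\mathbb{A}_{P^e}$ such that $$\sigma=\sum_{k=0}^{q^n-1}c_kB_k,$$ and for each $k=1,\dots,q^n-1$, $c_k$ is in the subgroup generated by $P^{\mu(k)}\pmod{P^e}$, where $\mu(k)=\left\lfloor\frac{\log_q k}{d}\right\rfloor$.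
   Context: $\mathbb{F}_q$ is the finite field with $q$ elements and $\mathbb{A}=\mathbb{F}_q[t]$. For a non-constant $f\in\mathbb{A}$, $\mathbb{A}_f=\mathbb{A}/f\mathbb{A}$ is the residue class ring modulo $f$, and $\mathcal{A}_f=\{h\in\mathbb{A}:\deg h<\deg f\}\cup\{0\}$, a complete set of representatives of the residue classes modulo $f$; for $h\in\mathcal{A}_f$, $\bar h$ denotes the residue class of $h$ modulo $f$. For non-constant $f,g\in\mathbb{A}$, a function $\sigma:\mathbb{A}_f\to\mathbb{A}_g$ is called congruence preserving if for all $h_1,h_2\in\mathcal{A}_f$ and every $h\in\mathbb{A}$ dividing $g$, $h_1\equiv h_2\pmod h$ implies $\sigma(\bar h_1)\equiv\sigma(\bar h_2)\pmod h$ (here $h_1,h_2$ are regarded as elements of $\mathbb{A}$, and reduction modulo $h$ of elements of $\mathbb{A}_g$ is well defined since $h\mid g$). Let $P$ be irreducible of degree $d$. Fix an ordering $b_0,b_1,\dots,b_{q^d-1}$ of all polynomials in $\mathbb{A}$ of degree less than $d$ (including $0$) such that $b_0=0$, $b_1=1$ and $\deg b_i\le\deg b_j$ for $1\le i\le j\le q^d-1$. For every $k\in\mathbb{N}=\{0,1,2,\dots\}$ with $q^d$-adic expansion $k=\sum_{i=0}^m l_iq^{di}$ ($0\le l_i<q^d$), put $b_k=b_{l_0}+b_{l_1}P+\dots+b_{l_m}P^m$. Define polynomials over $\mathbb{F}_q(t)$ by $$Q_0(x)=1,\qquad Q_k(x)=\frac{\prod_{j=0}^{k-1}(x-b_j)}{\prod_{j=0}^{k-1}(b_k-b_j)}\quad(k>0).$$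 It is a known fact (Wagner) that for all $k\in\mathbb{N}$ and $h\in\mathbb{A}$, $Q_k(h)$ has non-negative valuation at $P$, so its reduction modulo $P^e$ is a well-defined element of $\mathbb{A}_{P^e}$. The function $B_k:\mathbb{A}_f\to\mathbb{A}_{P^e}$ is defined by $B_k(\bar h)=Q_k(h)\bmod P^e$ for $h\in\mathcal{A}_f$.
   Formalization: "Subgroup generated by P^μ(k)" is read as the ideal generated by it (P^μ(k) divides c_k mod P^e); with the additive subgroup the claim fails, e.g. q=2, f=t², P=t, e=2, σ(h)=th, where c_1=t is not in {0,1}. -}

module Defs where

open import Algebra.Apartness.Bundles using (HeytingCommutativeRing; HeytingField)
open import Algebra.Bundles using (AbelianGroup; CommutativeRing; Semiring)
import Algebra.Definitions.RawSemiring as RawSemiringDefinitions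
import Algebra.Properties.AbelianGroup as AbelianGroupProperties
import Algebra.Properties.CommutativeSemigroup as CommutativeSemigroupProperties
import Algebra.Properties.Monoid.Sum as MonoidSum
import Algebra.Properties.Ring as RingProperties
import Algebra.Properties.Semiring.Divisibility as SemiringDivisibility
import Algebra.Properties.Semiring.Exp as Exponentiation
import Algebra.Solver.Ring.NaturalCoefficients.Default as SemiringSolver
open import Algebra.Structures using (IsCommutativeRing)
open import Data.Digit using (Expansion; fromDigits; toDigits)
open import Data.Fin.Base using (Fin; zero; suc; toℕ)
import Data.Fin.Properties as Fin
open import Data.List.Base using (List; []; _∷_; map)
open import Data.Nat.Base as ℕ using (ℕ; zero; suc; z≤n; s≤s)
open import Data.Nat.DivMod using (_divMod_; result; [m+kn]%n≡m%n; m<n⇒m%n≡m)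
open import Data.Nat.Induction using (<-rec)
import Data.Nat.Primality as ℕ
import Data.Nat.Properties as ℕ
open import Data.Product.Base using (∃; _×_; _,_; proj₁; proj₂)
open import Data.Sum.Base using (_⊎_; inj₁; inj₂)
open import Function.Bundles using (Func; Inverse; _⟨$⟩_)
open import Level using (Level; _⊔_)
open import Relation.Binary.PropositionalEquality as ≡ using (_≡_; subst)
import Relation.Binary.Reasoning.Setoid as SetoidReasoning
open import Relation.Nullary.Decidable as Dec using (Dec; yes; no)
open import Relation.Nullary.Negation using (¬_; contradiction)

private variable
  c ℓ ℓ₁ ℓ₂ : Level

fieldRing : HeytingField c ℓ₁ ℓ₂ → CommutativeRing c ℓ₁
fieldRing F = HeytingCommutativeRing.commutativeRing (HeytingField.heytingCommutativeRing F)

module Congruence (R : CommutativeRing c ℓ) where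
  open CommutativeRing R
  open SemiringDivisibility semiring using (_∣_; _,_)
  open RingProperties ring using (-‿distribˡ-*)
  open SemiringSolver commutativeSemiring using (solve; _:=_; _:+_; _:*_)
  open SetoidReasoning setoid

  infix 4 _≈_[mod_]

  record _≈_[mod_] (x y g : Carrier) : Set (c ⊔ ℓ) where
    constructor congruent
    field divides : g ∣ (x - y)

  open _≈_[mod_] public

  private variable
    g x y z u v : Carrier

  ≈+*⇒mod : ∀ m → x ≈ y + m * g → x ≈ y [mod g ]
  ≈+*⇒mod {x} {y} {g} m x≈y+mg = congruent (m , (begin
    m * g              ≈⟨ +-identityʳ _ ⟨
    m * g + 0#         ≈⟨ +-congˡ (-‿inverseʳ y) ⟨
    m * g + (y - y)    ≈⟨ solve 3 (λ a b d → a :+ (b :+ d) := (b :+ a) :+ d) refl (m * g) y (- y) ⟩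
    (y + m * g) - y    ≈⟨ +-congʳ x≈y+mg ⟨
    x - y              ∎))

  mod⇒≈+* : x ≈ y [mod g ] → ∃ λ m → x ≈ y + m * g
  mod⇒≈+* {x} {y} {g} (congruent (m , mg≈x-y)) = m , (begin
    x                  ≈⟨ +-identityʳ _ ⟨
    x + 0#             ≈⟨ +-congˡ (-‿inverseʳ y) ⟨
    x + (y - y)        ≈⟨ solve 3 (λ a b d → a :+ (b :+ d) := b :+ (a :+ d)) refl x y (- y) ⟩
    y + (x - y)        ≈⟨ +-congˡ mg≈x-y ⟨
    y + m * g          ∎)

  ≈⇒mod : x ≈ y → x ≈ y [mod g ]
  ≈⇒mod x≈y = ≈+*⇒mod 0# (trans x≈y (sym (trans (+-congˡ (zeroˡ _)) (+-identityʳ _))))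

  mod-sym : x ≈ y [mod g ] → y ≈ x [mod g ]
  mod-sym {x} {y} {g} x≈y with mod⇒≈+* x≈y
  ... | m , eq = ≈+*⇒mod (- m) (begin
    y                        ≈⟨ +-identityʳ _ ⟨
    y + 0#                   ≈⟨ +-congˡ (zeroˡ g) ⟨
    y + 0# * g               ≈⟨ +-congˡ (*-congʳ (-‿inverseʳ m)) ⟨
    y + (m - m) * g          ≈⟨ solve 4 (λ a b d h → a :+ (b :+ d) :* h := (a :+ b :* h) :+ d :* h) refl y m (- m) g ⟩
    (y + m * g) + - m * g    ≈⟨ +-congʳ eq ⟨
    x + - m * g              ∎)

  mod-trans : x ≈ y [mod g ] → y ≈ z [mod g ] → x ≈ z [mod g ]
  mod-trans {x} {y} {g} {z} x≈y y≈z with mod⇒≈+* x≈y | mod⇒≈+* y≈z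
  ... | m , eq | n , eq′ = ≈+*⇒mod (n + m) (begin
    x                        ≈⟨ eq ⟩
    y + m * g                ≈⟨ +-congʳ eq′ ⟩
    (z + n * g) + m * g      ≈⟨ solve 4 (λ a b d h → (a :+ b :* h) :+ d :* h := a :+ (b :+ d) :* h) refl z n m g ⟩
    z + (n + m) * g          ∎)

  mod-+-cong : x ≈ y [mod g ] → u ≈ v [mod g ] → x + u ≈ y + v [mod g ]
  mod-+-cong {x} {y} {g} {u} {v} x≈y u≈v with mod⇒≈+* x≈y | mod⇒≈+* u≈v
  ... | m , eq | n , eq′ = ≈+*⇒mod (m + n) (begin
    x + u                          ≈⟨ +-cong eq eq′ ⟩
    (y + m * g) + (v + n * g)      ≈⟨ solve 5 (λ a b d e h → (a :+ b :* h) :+ (d :+ e :* h) := (a :+ d) :+ (b :+ e) :* h) refl y m v n g ⟩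
    (y + v) + (m + n) * g          ∎)

  mod-*-cong : x ≈ y [mod g ] → u ≈ v [mod g ] → x * u ≈ y * v [mod g ]
  mod-*-cong {x} {y} {g} {u} {v} x≈y u≈v with mod⇒≈+* x≈y | mod⇒≈+* u≈v
  ... | m , eq | n , eq′ = ≈+*⇒mod (y * n + m * v + m * n * g) (begin
    x * u                          ≈⟨ *-cong eq eq′ ⟩
    (y + m * g) * (v + n * g)      ≈⟨ solve 5 (λ a b d e h → (a :+ b :* h) :* (d :+ e :* h) := a :* d :+ (a :* e :+ b :* d :+ b :* e :* h) :* h) refl y m v n g ⟩
    y * v + (y * n + m * v + m * n * g) * g ∎)

  mod-neg-cong : x ≈ y [mod g ] → - x ≈ - y [mod g ]
  mod-neg-cong {x} {y} {g} x≈y with mod⇒≈+* x≈y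
  ... | m , eq = ≈+*⇒mod (- m) (begin
    - x                ≈⟨ -‿cong eq ⟩
    - (y + m * g)      ≈⟨ ⁻¹-∙-comm y (m * g) ⟨
    - y + - (m * g)    ≈⟨ +-congˡ (-‿distribˡ-* m g) ⟩
    - y + - m * g      ∎)
    where open AbelianGroupProperties +-abelianGroup using (⁻¹-∙-comm)

  ∣⇒≈0 : g ∣ x → x ≈ 0# [mod g ]
  ∣⇒≈0 (m , mg≈x) = ≈+*⇒mod m (trans (sym mg≈x) (sym (+-identityˡ _)))

  ≈0⇒∣ : x ≈ 0# [mod g ] → g ∣ x
  ≈0⇒∣ x≈0 with mod⇒≈+* x≈0
  ... | m , eq = m , sym (trans eq (+-identityˡ _))

  abstract
    mod-isCommutativeRing : ∀ g → IsCommutativeRing (λ x y → x ≈ y [mod g ]) _+_ _*_ -_ 0# 1#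
    mod-isCommutativeRing g = record
      { isRing = record
        { +-isAbelianGroup = record
          { isGroup = record
            { isMonoid = record
              { isSemigroup = record
                { isMagma = record
                  { isEquivalence = record { refl = ≈⇒mod refl ; sym = mod-sym ; trans = mod-trans }
                  ; ∙-cong = mod-+-cong
                  }
                ; assoc = λ x y z → ≈⇒mod (+-assoc x y z)
                }
              ; identity = (λ x → ≈⇒mod (+-identityˡ x)) , (λ x → ≈⇒mod (+-identityʳ x))
              }
            ; inverse = (λ x → ≈⇒mod (-‿inverseˡ x)) , (λ x → ≈⇒mod (-‿inverseʳ x))
            ; ⁻¹-cong = mod-neg-cong
            }
          ; comm = λ x y → ≈⇒mod (+-comm x y)
          }
        ; *-cong = mod-*-cong
        ; *-assoc = λ x y z → ≈⇒mod (*-assoc x y z)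
        ; *-identity = (λ x → ≈⇒mod (*-identityˡ x)) , (λ x → ≈⇒mod (*-identityʳ x))
        ; distrib = (λ x y z → ≈⇒mod (distribˡ x y z)) , (λ x y z → ≈⇒mod (distribʳ x y z))
        }
      ; *-comm = λ x y → ≈⇒mod (*-comm x y)
      }

infixl 7 _/_

-- The residue class ring of R modulo g has the elements of R itself as
-- elements; congruence modulo g is its equality.
_/_ : (R : CommutativeRing c ℓ) → CommutativeRing.Carrier R → CommutativeRing c (c ⊔ ℓ)
R / g = record
  { Carrier = Carrier
  ; _≈_ = λ x y → x ≈ y [mod g ]
  ; _+_ = _+_
  ; _*_ = _*_
  ; -_ = -_
  ; 0# = 0#
  ; 1# = 1#
  ; isCommutativeRing = mod-isCommutativeRing g
  }
  where
  open CommutativeRing R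
  open Congruence R

-- A polynomial is the list of its coefficients, constant term first.
-- Trailing zeros are allowed: two lists are equal polynomials when all
-- their coefficients agree.
module Polynomials (R : CommutativeRing c ℓ) where
  private module R = CommutativeRing R
  private module R-Properties = RingProperties R.ring

  infix  4 _≈_
  infixl 6 _+_
  infixl 7 _*_ _·_
  infix  8 -_

  Polynomial : Set c
  Polynomial = List R.Carrier

  coeff : Polynomial → ℕ → R.Carrier
  coeff []      _       = R.0#
  coeff (a ∷ p) zero    = a
  coeff (a ∷ p) (suc i) = coeff p i

  record _≈_ (p q : Polynomial) : Set ℓ where
    constructor coeffwise
    field at : ∀ i → coeff p i R.≈ coeff q i

  open _≈_ public

  _+_ : Polynomial → Polynomial → Polynomial
  []      + q       = q
  (a ∷ p) + []      = a ∷ p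
  (a ∷ p) + (b ∷ q) = (a R.+ b) ∷ (p + q)

  -_ : Polynomial → Polynomial
  - p = map (λ a → R.- a) p

  _·_ : R.Carrier → Polynomial → Polynomial
  a · p = map (a R.*_) p

  _*_ : Polynomial → Polynomial → Polynomial
  []      * q = []
  (a ∷ p) * q = a · q + (R.0# ∷ p * q)

  coeff-+ : ∀ p q i → coeff (p + q) i R.≈ coeff p i R.+ coeff q i
  coeff-+ []      q       i       = R.sym (R.+-identityˡ _)
  coeff-+ (a ∷ p) []      i       = R.sym (R.+-identityʳ _)
  coeff-+ (a ∷ p) (b ∷ q) zero    = R.refl
  coeff-+ (a ∷ p) (b ∷ q) (suc i) = coeff-+ p q i

  coeff-neg : ∀ p i → coeff (- p) i R.≈ R.- coeff p i
  coeff-neg []      i       = R.sym R-Properties.-0#≈0#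
  coeff-neg (a ∷ p) zero    = R.refl
  coeff-neg (a ∷ p) (suc i) = coeff-neg p i

  coeff-· : ∀ a p i → coeff (a · p) i R.≈ a R.* coeff p i
  coeff-· a []      i       = R.sym (R.zeroʳ a)
  coeff-· a (b ∷ p) zero    = R.refl
  coeff-· a (b ∷ p) (suc i) = coeff-· a p i

  private
    ≈-refl : ∀ {p} → p ≈ p
    ≈-refl = coeffwise λ _ → R.refl

    ≈-sym : ∀ {p q} → p ≈ q → q ≈ p
    ≈-sym p≈q = coeffwise λ i → R.sym (at p≈q i)

    ≈-trans : ∀ {p q r} → p ≈ q → q ≈ r → p ≈ r
    ≈-trans p≈q q≈r = coeffwise λ i → R.trans (at p≈q i) (at q≈r i)

    +-cong : ∀ {p q r s} → p ≈ q → r ≈ s → p + r ≈ q + s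
    +-cong {p} {q} {r} {s} p≈q r≈s = coeffwise λ i →
      R.trans (coeff-+ p r i) (R.trans (R.+-cong (at p≈q i) (at r≈s i)) (R.sym (coeff-+ q s i)))

    +-assoc : ∀ p q r → (p + q) + r ≈ p + (q + r)
    +-assoc p q r = coeffwise λ i →
      R.trans (coeff-+ (p + q) r i)
        (R.trans (R.+-congʳ (coeff-+ p q i))
          (R.trans (R.+-assoc _ _ _)
            (R.trans (R.+-congˡ (R.sym (coeff-+ q r i))) (R.sym (coeff-+ p (q + r) i)))))

    +-comm : ∀ p q → p + q ≈ q + p
    +-comm p q = coeffwise λ i →
      R.trans (coeff-+ p q i) (R.trans (R.+-comm _ _) (R.sym (coeff-+ q p i)))

    +-identityʳ : ∀ p → p + [] ≈ p
    +-identityʳ p = coeffwise λ i → R.trans (coeff-+ p [] i) (R.+-identityʳ _)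

    neg-cong : ∀ {p q} → p ≈ q → - p ≈ - q
    neg-cong {p} {q} p≈q = coeffwise λ i →
      R.trans (coeff-neg p i) (R.trans (R.-‿cong (at p≈q i)) (R.sym (coeff-neg q i)))

    neg-inverseʳ : ∀ p → p + - p ≈ []
    neg-inverseʳ p = coeffwise λ i →
      R.trans (coeff-+ p (- p) i) (R.trans (R.+-congˡ (coeff-neg p i)) (R.-‿inverseʳ _))

  +-abelianGroup : AbelianGroup c ℓ
  +-abelianGroup = record
    { Carrier = Polynomial
    ; _≈_ = _≈_
    ; _∙_ = _+_
    ; ε = []
    ; _⁻¹ = -_
    ; isAbelianGroup = record
      { isGroup = record
        { isMonoid = record
          { isSemigroup = record
            { isMagma = record
              { isEquivalence = record { refl = ≈-refl ; sym = ≈-sym ; trans = ≈-trans }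
              ; ∙-cong = +-cong
              }
            ; assoc = +-assoc
            }
          ; identity = (λ _ → ≈-refl) , +-identityʳ
          }
        ; inverse = (λ p → ≈-trans (+-comm (- p) p) (neg-inverseʳ p)) , neg-inverseʳ
        ; ⁻¹-cong = neg-cong
        }
      ; comm = +-comm
      }
    }

  open CommutativeSemigroupProperties (AbelianGroup.commutativeSemigroup +-abelianGroup)
    using (interchange; x∙yz≈y∙xz)
  open SetoidReasoning (AbelianGroup.setoid +-abelianGroup)

  ∷-cong : ∀ {a b p q} → a R.≈ b → p ≈ q → a ∷ p ≈ b ∷ q
  ∷-cong a≈b p≈q = coeffwise λ { zero → a≈b ; (suc i) → at p≈q i }

  0∷[]≈[] : R.0# ∷ [] ≈ []
  0∷[]≈[] = coeffwise λ { zero → R.refl ; (suc i) → R.refl }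

  private
    ·-cong : ∀ {a b p q} → a R.≈ b → p ≈ q → a · p ≈ b · q
    ·-cong {a} {b} {p} {q} a≈b p≈q = coeffwise λ i →
      R.trans (coeff-· a p i) (R.trans (R.*-cong a≈b (at p≈q i)) (R.sym (coeff-· b q i)))

    ·-distribˡ : ∀ a p q → a · (p + q) ≈ a · p + a · q
    ·-distribˡ a p q = coeffwise λ i →
      R.trans (coeff-· a (p + q) i)
        (R.trans (R.*-congˡ (coeff-+ p q i))
          (R.trans (R.distribˡ _ _ _)
            (R.trans (R.+-cong (R.sym (coeff-· a p i)) (R.sym (coeff-· a q i)))
              (R.sym (coeff-+ (a · p) (a · q) i)))))

    ·-assoc : ∀ a b p → (a R.* b) · p ≈ a · (b · p)
    ·-assoc a b p = coeffwise λ i →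
      R.trans (coeff-· (a R.* b) p i)
        (R.trans (R.*-assoc _ _ _)
          (R.trans (R.*-congˡ (R.sym (coeff-· b p i))) (R.sym (coeff-· a (b · p) i))))

    ·-zeroˡ : ∀ p → R.0# · p ≈ []
    ·-zeroˡ p = coeffwise λ i → R.trans (coeff-· R.0# p i) (R.zeroˡ _)

    ·-identityˡ : ∀ p → R.1# · p ≈ p
    ·-identityˡ p = coeffwise λ i → R.trans (coeff-· R.1# p i) (R.*-identityˡ _)

    *-congˡ : ∀ p {q r} → q ≈ r → p * q ≈ p * r
    *-congˡ []      q≈r = ≈-refl
    *-congˡ (a ∷ p) q≈r = +-cong (·-cong R.refl q≈r) (∷-cong R.refl (*-congˡ p q≈r))

    *-zeroʳ : ∀ p → p * [] ≈ []
    *-zeroʳ []      = ≈-refl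
    *-zeroʳ (a ∷ p) = ≈-trans (∷-cong R.refl (*-zeroʳ p)) 0∷[]≈[]

    *-∷ : ∀ p b q → p * (b ∷ q) ≈ b · p + (R.0# ∷ p * q)
    *-∷ []      b q = ≈-sym 0∷[]≈[]
    *-∷ (a ∷ p) b q = ∷-cong (R.+-congʳ (R.*-comm a b)) (begin
      a · q + p * (b ∷ q)                  ≈⟨ +-cong ≈-refl (*-∷ p b q) ⟩
      a · q + (b · p + (R.0# ∷ p * q))     ≈⟨ x∙yz≈y∙xz (a · q) (b · p) _ ⟩
      b · p + (a · q + (R.0# ∷ p * q))     ∎)

    *-comm : ∀ p q → p * q ≈ q * p
    *-comm []      q = ≈-sym (*-zeroʳ q)
    *-comm (a ∷ p) q = begin
      a · q + (R.0# ∷ p * q)   ≈⟨ +-cong ≈-refl (∷-cong R.refl (*-comm p q)) ⟩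
      a · q + (R.0# ∷ q * p)   ≈⟨ *-∷ q a p ⟨
      q * (a ∷ p)              ∎

    *-cong : ∀ {p q r s} → p ≈ q → r ≈ s → p * r ≈ q * s
    *-cong {p} {q} {r} {s} p≈q r≈s = begin
      p * r   ≈⟨ *-congˡ p r≈s ⟩
      p * s   ≈⟨ *-comm p s ⟩
      s * p   ≈⟨ *-congˡ s p≈q ⟩
      s * q   ≈⟨ *-comm s q ⟩
      q * s   ∎

    *-distribˡ : ∀ p q r → p * (q + r) ≈ p * q + p * r
    *-distribˡ []      q r = ≈-refl
    *-distribˡ (a ∷ p) q r = begin
      a · (q + r) + (R.0# ∷ p * (q + r))
        ≈⟨ +-cong (·-distribˡ a q r) (∷-cong (R.sym (R.+-identityˡ _)) (*-distribˡ p q r)) ⟩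
      (a · q + a · r) + ((R.0# ∷ p * q) + (R.0# ∷ p * r))
        ≈⟨ interchange (a · q) (a · r) _ _ ⟩
      (a ∷ p) * q + (a ∷ p) * r ∎

    *-distribʳ : ∀ p q r → (q + r) * p ≈ q * p + r * p
    *-distribʳ p q r = begin
      (q + r) * p     ≈⟨ *-comm (q + r) p ⟩
      p * (q + r)     ≈⟨ *-distribˡ p q r ⟩
      p * q + p * r   ≈⟨ +-cong (*-comm p q) (*-comm p r) ⟩
      q * p + r * p   ∎

    ·-* : ∀ a p q → (a · p) * q ≈ a · (p * q)
    ·-* a []      q = ≈-refl
    ·-* a (b ∷ p) q = begin
      (a R.* b) · q + (R.0# ∷ (a · p) * q)
        ≈⟨ +-cong (·-assoc a b q) (∷-cong (R.sym (R.zeroʳ a)) (·-* a p q)) ⟩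
      a · (b · q) + a · (R.0# ∷ p * q)
        ≈⟨ ·-distribˡ a (b · q) (R.0# ∷ p * q) ⟨
      a · ((b ∷ p) * q) ∎

    *-assoc : ∀ p q r → (p * q) * r ≈ p * (q * r)
    *-assoc []      q r = ≈-refl
    *-assoc (a ∷ p) q r = begin
      (a · q + (R.0# ∷ p * q)) * r
        ≈⟨ *-distribʳ r (a · q) (R.0# ∷ p * q) ⟩
      (a · q) * r + (R.0# · r + (R.0# ∷ (p * q) * r))
        ≈⟨ +-cong (·-* a q r) (+-cong (·-zeroˡ r) (∷-cong R.refl (*-assoc p q r))) ⟩
      a · (q * r) + (R.0# ∷ p * (q * r)) ∎

    *-identityˡ : ∀ p → (R.1# ∷ []) * p ≈ p
    *-identityˡ p = begin
      R.1# · p + (R.0# ∷ [])   ≈⟨ +-cong (·-identityˡ p) 0∷[]≈[] ⟩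
      p + []                   ≈⟨ +-identityʳ p ⟩
      p                        ∎

  abstract
    isCommutativeRing : IsCommutativeRing _≈_ _+_ _*_ -_ [] (R.1# ∷ [])
    isCommutativeRing = record
      { isRing = record
        { +-isAbelianGroup = AbelianGroup.isAbelianGroup +-abelianGroup
        ; *-cong = *-cong
        ; *-assoc = *-assoc
        ; *-identity = *-identityˡ , λ p → ≈-trans (*-comm p _) (*-identityˡ p)
        ; distrib = *-distribˡ , *-distribʳ
        }
      ; *-comm = *-comm
      }

  ring : CommutativeRing c ℓ
  ring = record
    { Carrier = Polynomial
    ; _≈_ = _≈_
    ; _+_ = _+_
    ; _*_ = _*_
    ; -_ = -_
    ; 0# = []
    ; 1# = R.1# ∷ []
    ; isCommutativeRing = isCommutativeRing
    }

  -- deg p < n, where the zero polynomial has degree less than every n.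
  deg_<_ : Polynomial → ℕ → Set ℓ
  deg p < n = ∀ i → n ℕ.≤ i → coeff p i R.≈ R.0#

  -- p is non-zero and has degree n.
  deg_≡_ : Polynomial → ℕ → Set ℓ
  deg p ≡ n = ¬ coeff p n R.≈ R.0# × deg p < suc n

module Fractions (R : CommutativeRing c ℓ) where
  open CommutativeRing R
  open SemiringDivisibility semiring using (_∣_)

  infix 4 _≃_

  record Fraction : Set (c ⊔ ℓ) where
    field
      num   : Carrier
      den   : Carrier
      den≉0 : ¬ den ≈ 0#

  open Fraction public

  _≃_ : Fraction → Fraction → Set ℓ
  x ≃ y = num x * den y ≈ num y * den x

  -- For an irreducible element P of a unique factorisation domain: x has
  -- non-negative valuation at P.
  IntegralAt : Carrier → Fraction → Set (c ⊔ ℓ)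
  IntegralAt P x = ∃ λ y → x ≃ y × ¬ P ∣ den y

NoZeroDivisors : CommutativeRing c ℓ → Set (c ⊔ ℓ)
NoZeroDivisors R = ∀ x y → x * y ≈ 0# → x ≈ 0# ⊎ y ≈ 0#
  where open CommutativeRing R

module Coprimality (R : CommutativeRing c ℓ) where
  open CommutativeRing R
  open SemiringDivisibility semiring using (_∣_)

  Comaximal : Carrier → Carrier → Set (c ⊔ ℓ)
  Comaximal w P = ∃ λ u → ∃ λ v → u * w + v * P ≈ 1#

  BezoutAt : Carrier → Set (c ⊔ ℓ)
  BezoutAt P = ∀ w → ¬ P ∣ w → Comaximal w P

module Reduction
  (R : CommutativeRing c ℓ) (noZeroDivisors : NoZeroDivisors R)
  (P : CommutativeRing.Carrier R) (bezout : Coprimality.BezoutAt R P)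
  where

  open CommutativeRing R
  open Congruence R
  open Fractions R
  open RingProperties ring using ([y-z]x≈yx-zx)
  open AbelianGroupProperties +-abelianGroup using (x∙y⁻¹≈ε⇒x≈y; x≈y⇒x∙y⁻¹≈ε)
  open SemiringDivisibility semiring using (_∣_; _,_)
  open Exponentiation semiring using (_^_)
  open SemiringSolver commutativeSemiring using (solve; _:=_; _:+_; _:*_)
  open SetoidReasoning setoid

  private variable
    x y z w : Carrier

  *-cancelʳ : ¬ z ≈ 0# → x * z ≈ y * z → x ≈ y
  *-cancelʳ {z} {x} {y} z≉0 xz≈yz
    with noZeroDivisors (x - y) z (trans ([y-z]x≈yx-zx z x y) (x≈y⇒x∙y⁻¹≈ε xz≈yz))
  ... | inj₁ x-y≈0 = x∙y⁻¹≈ε⇒x≈y x y x-y≈0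
  ... | inj₂ z≈0   = contradiction z≈0 z≉0

  abstract
    inverseMod : ∀ e w → ¬ P ∣ w → ∃ λ u → u * w ≈ 1# [mod P ^ e ]
    inverseMod zero    w P∤w = 0# , mod-sym (≈+*⇒mod 1# (begin
      1#                  ≈⟨ *-identityˡ 1# ⟨
      1# * 1#             ≈⟨ +-identityˡ _ ⟨
      0# + 1# * 1#        ≈⟨ +-congʳ (zeroˡ w) ⟨
      0# * w + 1# * 1#    ∎))
    inverseMod (suc e) w P∤w with inverseMod e w P∤w | bezout w P∤w
    ... | u , uw≈1 | u′ , v′ , u′w+v′P≈1 with mod⇒≈+* (mod-sym uw≈1)
    ...   | v , 1≈uw+vPᵉ = u * (u′ * w + v′ * P) + v * P ^ e * u′ ,
      mod-sym (≈+*⇒mod (v * v′) (begin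
        1#                                       ≈⟨ *-identityʳ 1# ⟨
        1# * 1#                                  ≈⟨ *-cong 1≈uw+vPᵉ (sym u′w+v′P≈1) ⟩
        (u * w + v * P ^ e) * (u′ * w + v′ * P)
          ≈⟨ solve 7 (λ u v w u′ v′ P Pᵉ →
               (u :* w :+ v :* Pᵉ) :* (u′ :* w :+ v′ :* P) :=
               (u :* (u′ :* w :+ v′ :* P) :+ v :* Pᵉ :* u′) :* w :+ v :* v′ :* (P :* Pᵉ))
               refl u v w u′ v′ P (P ^ e) ⟩
        (u * (u′ * w + v′ * P) + v * P ^ e * u′) * w + v * v′ * (P * P ^ e) ∎))

  -- The residue modulo P ^ e of a fraction of non-negative valuation at P:
  -- written as z / w with P ∤ w, it is z w⁻¹.
  reduce : ∀ e x → IntegralAt P x → Carrier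
  reduce e x (y , _ , P∤den) = num y * proj₁ (inverseMod e (den y) P∤den)

  reduce-spec : ∀ e x (integral : IntegralAt P x) → num x * w ≈ z * den x →
                w * reduce e x integral ≈ z [mod P ^ e ]
  reduce-spec {w} {z} e x (y , x≃y , P∤den) x≈z/w with inverseMod e (den y) P∤den
  ... | u , u*den≈1 = mod-trans (≈⇒mod (begin
    w * (num y * u)     ≈⟨ solve 3 (λ a b d → a :* (b :* d) := (b :* a) :* d) refl w (num y) u ⟩
    num y * w * u       ≈⟨ *-congʳ cross ⟨
    z * den y * u       ≈⟨ solve 3 (λ a b d → (a :* b) :* d := a :* (d :* b)) refl z (den y) u ⟩
    z * (u * den y)     ∎))
    (mod-trans (mod-*-cong (≈⇒mod refl) u*den≈1) (≈⇒mod (*-identityʳ z)))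
    where
    cross : z * den y ≈ num y * w
    cross = *-cancelʳ (den≉0 x) (begin
      z * den y * den x     ≈⟨ solve 3 (λ a b d → (a :* b) :* d := (a :* d) :* b) refl z (den y) (den x) ⟩
      z * den x * den y     ≈⟨ *-congʳ x≈z/w ⟨
      num x * w * den y     ≈⟨ solve 3 (λ a b d → (a :* b) :* d := (a :* d) :* b) refl (num x) w (den y) ⟩
      num x * den y * w     ≈⟨ *-congʳ x≃y ⟩
      num y * den x * w     ≈⟨ solve 3 (λ a b d → (a :* b) :* d := (a :* d) :* b) refl (num y) (den x) w ⟩
      num y * w * den x     ∎)

  reduce-unique : ∀ e x (integral : IntegralAt P x) → ¬ P ∣ w → num x * w ≈ z * den x →
                  ∀ r → w * r ≈ z [mod P ^ e ] → reduce e x integral ≈ r [mod P ^ e ]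
  reduce-unique {w} {z} e x integral P∤w x≈z/w r wr≈z with inverseMod e w P∤w
  ... | u , uw≈1 = mod-trans (mod-sym (cancel (reduce e x integral)))
    (mod-trans (mod-*-cong (≈⇒mod refl) (mod-trans (reduce-spec e x integral x≈z/w) (mod-sym wr≈z)))
      (cancel r))
    where
    cancel : ∀ t → u * (w * t) ≈ t [mod P ^ e ]
    cancel t = mod-trans (≈⇒mod (sym (*-assoc u w t)))
      (mod-trans (mod-*-cong uw≈1 (≈⇒mod refl)) (≈⇒mod (*-identityˡ t)))

  reduce-cong : ∀ e x y (i : IntegralAt P x) (j : IntegralAt P y) → x ≃ y →
                reduce e x i ≈ reduce e y j [mod P ^ e ]
  reduce-cong e x y i j@(t , y≃t , P∤den) x≃y =
    reduce-unique e x i P∤den x≃t (reduce e y j) (reduce-spec e y j y≃t)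
    where
    x≃t : x ≃ t
    x≃t = *-cancelʳ (den≉0 y) (begin
      num x * den t * den y     ≈⟨ solve 3 (λ a b d → (a :* b) :* d := (a :* d) :* b) refl (num x) (den t) (den y) ⟩
      num x * den y * den t     ≈⟨ *-congʳ x≃y ⟩
      num y * den x * den t     ≈⟨ solve 3 (λ a b d → (a :* b) :* d := (a :* d) :* b) refl (num y) (den x) (den t) ⟩
      num y * den t * den x     ≈⟨ *-congʳ y≃t ⟩
      num t * den y * den x     ≈⟨ solve 3 (λ a b d → (a :* b) :* d := (a :* d) :* b) refl (num t) (den y) (den x) ⟩
      num t * den x * den y     ∎)

module NewtonBasis
  (R : CommutativeRing c ℓ) (P : CommutativeRing.Carrier R)
  (N : ℕ) (2≤N : 2 ℕ.≤ N) (b : Fin N → CommutativeRing.Carrier R)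
  where

  open CommutativeRing R
  open Congruence R
  open RawSemiringDefinitions (Semiring.rawSemiring semiring) using (product; Prime)

  -- Σᵢ b(lᵢ) Pⁱ for the expansion with digits l₀, l₁, …
  evaluate : Expansion N → Carrier
  evaluate []       = 0#
  evaluate (l ∷ ls) = b l + P * evaluate ls

  -- The extension of b to all of ℕ through N-adic expansions.
  extend : ℕ → Carrier
  extend k = evaluate (proj₁ (toDigits N {Dec.fromWitness 2≤N} k))

  falling : ℕ → Carrier → Carrier
  falling k x = product {k} λ j → x - extend (toℕ j)

  record CompleteResidues : Set (c ⊔ ℓ) where
    field
      b-zero     : ∀ i → toℕ i ≡ 0 → b i ≈ 0#
      b-distinct : ∀ i j → b i ≈ b j [mod P ] → i ≡ j
      b-complete : ∀ x → ∃ λ i → x ≈ b i [mod P ]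

  module Integrality
    (noZeroDivisors : NoZeroDivisors R) (prime : Prime P) (residues : CompleteResidues)
    where

    open Prime prime using () renaming (p≉0 to P≉0; p∤1 to P∤1; split-∣ to P-split-∣)
    open CompleteResidues residues
    open Exponentiation semiring using (_^_; ^-homo-*; ^-congʳ)
    open SemiringDivisibility semiring using (_∣_; _∣0; ∣ʳ-respʳ-≈)
    open SemiringSolver commutativeSemiring using (solve; _:=_; _:+_; _:*_)
    open RingProperties ring using (x[y-z]≈xy-xz)
    open Fractions R
    open SetoidReasoning setoid

    private
      instance
        N≢0 : ℕ.NonZero N
        N≢0 = ℕ.>-nonZero (ℕ.≤-trans (s≤s z≤n) 2≤N)

    ∤-* : ∀ {x y} → ¬ P ∣ x → ¬ P ∣ y → ¬ P ∣ x * y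
    ∤-* P∤x P∤y P∣xy with P-split-∣ P∣xy
    ... | inj₁ P∣x = P∤x P∣x
    ... | inj₂ P∣y = P∤y P∣y

    evaluate-zero : ∀ ls → fromDigits ls ≡ 0 → evaluate ls ≈ 0#
    evaluate-zero []       _  = refl
    evaluate-zero (l ∷ ls) eq = begin
      b l + P * evaluate ls   ≈⟨ +-cong (b-zero l (ℕ.m+n≡0⇒m≡0 (toℕ l) eq)) (*-congˡ (evaluate-zero ls ls≡0)) ⟩
      0# + P * 0#             ≈⟨ +-identityˡ _ ⟩
      P * 0#                  ≈⟨ zeroʳ P ⟩
      0#                      ∎
      where
      ls≡0 : fromDigits ls ≡ 0
      ls≡0 = ℕ.m*n≡0⇒m≡0 (fromDigits ls) N (ℕ.m+n≡0⇒n≡0 (toℕ l) eq)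

    digits-unique : ∀ (i j : Fin N) m n → toℕ i ℕ.+ m ℕ.* N ≡ toℕ j ℕ.+ n ℕ.* N → i ≡ j × m ≡ n
    digits-unique i j m n eq = i≡j , ℕ.*-cancelʳ-≡ m n N (ℕ.+-cancelˡ-≡ (toℕ j) _ _
        (≡.trans (≡.cong (λ l → toℕ l ℕ.+ m ℕ.* N) (≡.sym i≡j)) eq))
      where
      remainder : ∀ (l : Fin N) k → (toℕ l ℕ.+ k ℕ.* N) ℕ.% N ≡ toℕ l
      remainder l k = ≡.trans ([m+kn]%n≡m%n (toℕ l) k N) (m<n⇒m%n≡m (Fin.toℕ<n l))
      i≡j : i ≡ j
      i≡j = Fin.toℕ-injective (≡.trans (≡.sym (remainder i m))
        (≡.trans (≡.cong (ℕ._% N) eq) (remainder j n)))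

    evaluate-unique : ∀ ls ls′ → fromDigits ls ≡ fromDigits ls′ → evaluate ls ≈ evaluate ls′
    evaluate-unique []       ls′        eq = sym (evaluate-zero ls′ (≡.sym eq))
    evaluate-unique (l ∷ ls) []         eq = evaluate-zero (l ∷ ls) eq
    evaluate-unique (l ∷ ls) (l′ ∷ ls′) eq
      with digits-unique l l′ (fromDigits ls) (fromDigits ls′) eq
    ... | l≡l′ , tails = +-cong (reflexive (≡.cong b l≡l′)) (*-congˡ (evaluate-unique ls ls′ tails))

    extend-step : ∀ i u → extend (toℕ i ℕ.+ u ℕ.* N) ≈ b i + P * extend u
    extend-step i u = evaluate-unique (proj₁ (toDigits N k)) (i ∷ proj₁ (toDigits N u))
      (≡.trans (proj₂ (toDigits N k)) (≡.cong (λ m → toℕ i ℕ.+ m ℕ.* N) (≡.sym (proj₂ (toDigits N u)))))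
      where k = toℕ i ℕ.+ u ℕ.* N

    falling-suc : ∀ k x → falling (suc k) x ≈ falling k x * (x - extend k)
    falling-suc k x = trans (sum-init-last (λ (j : Fin (suc k)) → x - extend (toℕ j)))
      (*-cong (sum-cong-≋ {k} λ j → same (Fin.toℕ-inject₁ j)) (same (Fin.toℕ-fromℕ k)))
      where
      open MonoidSum *-monoid using (sum-init-last; sum-cong-≋)
      same : ∀ {i j} → i ≡ j → x - extend i ≈ x - extend j
      same i≡j = +-congˡ (-‿cong (reflexive (≡.cong extend i≡j)))

    falling-+ : ∀ k m x → ∃ λ r → falling (k ℕ.+ m) x ≈ falling k x * r
    falling-+ k zero    x = 1# , trans (reflexive (≡.cong (λ n → falling n x) (ℕ.+-identityʳ k))) (sym (*-identityʳ _))
    falling-+ k (suc m) x with falling-+ k m x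
    ... | r , eq = r * (x - extend (k ℕ.+ m)) , (begin
      falling (k ℕ.+ suc m) x                     ≈⟨ reflexive (≡.cong (λ n → falling n x) (ℕ.+-suc k m)) ⟩
      falling (suc (k ℕ.+ m)) x                   ≈⟨ falling-suc (k ℕ.+ m) x ⟩
      falling (k ℕ.+ m) x * (x - extend (k ℕ.+ m))  ≈⟨ *-congʳ eq ⟩
      falling k x * r * (x - extend (k ℕ.+ m))    ≈⟨ *-assoc _ _ _ ⟩
      falling k x * (r * (x - extend (k ℕ.+ m)))  ∎)

    extend-mod : ∀ i u → extend (toℕ i ℕ.+ u ℕ.* N) ≈ b i [mod P ]
    extend-mod i u = ≈+*⇒mod (extend u) (trans (extend-step i u) (+-congˡ (*-comm P (extend u))))

    -- Among the factors x - extend j with j < k, those with j ≡ i modulo N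
    -- are divisible by P and the others are prime to P.
    record Split (i : Fin N) (x y : Carrier) (k : ℕ) : Set (c ⊔ ℓ) where
      constructor split
      field
        a     : ℕ
        U     : Carrier
        lower : k ℕ.≤ toℕ i ℕ.+ a ℕ.* N
        upper : toℕ i ℕ.+ a ℕ.* N ℕ.< k ℕ.+ N
        P∤U   : ¬ P ∣ U
        eq    : falling k x ≈ U * (P ^ a * falling a y)

    splitting : ∀ i x y → x ≈ b i + P * y → ∀ k → Split i x y k
    splitting i x y x≈ zero = split 0 1# z≤n (subst (ℕ._< N) (≡.sym (ℕ.+-identityʳ _)) (Fin.toℕ<n i)) P∤1
      (sym (trans (*-identityˡ _) (*-identityˡ _)))
    splitting i x y x≈ (suc k) with splitting i x y x≈ k
    ... | split a U lower upper P∤U eq with k ℕ.≟ toℕ i ℕ.+ a ℕ.* N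
    ...   | yes k≡ = split (suc a) U
      (subst (suc k ℕ.≤_) shuffle (ℕ.+-mono-≤ (ℕ.≤-trans (s≤s z≤n) 2≤N) (ℕ.≤-reflexive k≡)))
      (subst (ℕ._< suc k ℕ.+ N) shuffle
        (s≤s (ℕ.≤-reflexive (≡.trans (ℕ.+-comm N _) (≡.cong (ℕ._+ N) (≡.sym k≡))))))
      P∤U (begin
        falling (suc k) x                              ≈⟨ falling-suc k x ⟩
        falling k x * (x - extend k)                   ≈⟨ *-cong eq factor ⟩
        U * (P ^ a * falling a y) * (P * (y - extend a))
          ≈⟨ solve 5 (λ U Pᵃ N P r → U :* (Pᵃ :* N) :* (P :* r) := U :* ((P :* Pᵃ) :* (N :* r)))
               refl U (P ^ a) (falling a y) P (y - extend a) ⟩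
        U * (P ^ suc a * (falling a y * (y - extend a)))  ≈⟨ *-congˡ (*-congˡ (falling-suc a y)) ⟨
        U * (P ^ suc a * falling (suc a) y)            ∎)
      where
      shuffle : N ℕ.+ (toℕ i ℕ.+ a ℕ.* N) ≡ toℕ i ℕ.+ (N ℕ.+ a ℕ.* N)
      shuffle = x∙yz≈y∙xz N (toℕ i) (a ℕ.* N)
        where open CommutativeSemigroupProperties ℕ.+-commutativeSemigroup using (x∙yz≈y∙xz)
      factor : x - extend k ≈ P * (y - extend a)
      factor = begin
        x - extend k                                     ≈⟨ +-cong x≈ (-‿cong (reflexive (≡.cong extend k≡))) ⟩
        b i + P * y - extend (toℕ i ℕ.+ a ℕ.* N)         ≈⟨ +-congˡ (-‿cong (extend-step i a)) ⟩
        b i + P * y - (b i + P * extend a)               ≈⟨ +-congˡ (⁻¹-∙-comm (b i) (P * extend a)) ⟨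
        b i + P * y + (- b i - P * extend a)             ≈⟨ interchange (b i) (P * y) (- b i) (- (P * extend a)) ⟩
        (b i - b i) + (P * y - P * extend a)             ≈⟨ +-congʳ (-‿inverseʳ (b i)) ⟩
        0# + (P * y - P * extend a)                      ≈⟨ +-identityˡ _ ⟩
        P * y - P * extend a                             ≈⟨ x[y-z]≈xy-xz P y (extend a) ⟨
        P * (y - extend a)                               ∎
        where
        open AbelianGroupProperties +-abelianGroup using (⁻¹-∙-comm)
        open CommutativeSemigroupProperties +-commutativeSemigroup using (interchange)
    ...   | no k≢ = split a (U * (x - extend k)) k<
      (ℕ.<-trans upper (s≤s ℕ.≤-refl)) (∤-* P∤U P∤factor) (begin
        falling (suc k) x                              ≈⟨ falling-suc k x ⟩
        falling k x * (x - extend k)                   ≈⟨ *-congʳ eq ⟩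
        U * (P ^ a * falling a y) * (x - extend k)
          ≈⟨ solve 3 (λ U N r → U :* N :* r := U :* r :* N) refl U (P ^ a * falling a y) (x - extend k) ⟩
        U * (x - extend k) * (P ^ a * falling a y)     ∎)
      where
      k< : k ℕ.< toℕ i ℕ.+ a ℕ.* N
      k< = ℕ.≤∧≢⇒< lower k≢
      P∤factor : ¬ P ∣ (x - extend k)
      P∤factor P∣ with k divMod N
      ... | result u j k≡ = ℕ.<-irrefl ≡.refl (ℕ.<-≤-trans upper (ℕ.≤-trans (ℕ.≤-reflexive (≡.trans (≡.cong (ℕ._+ N) k≡′) shuffle)) next))
        where
        i≡j : i ≡ j
        i≡j = b-distinct i j (mod-trans (mod-sym (≈+*⇒mod y (trans x≈ (+-congˡ (*-comm P y)))))
          (mod-trans (congruent P∣) (mod-trans (≈⇒mod (reflexive (≡.cong extend k≡))) (extend-mod j u))))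
        k≡′ : k ≡ toℕ i ℕ.+ u ℕ.* N
        k≡′ = subst (λ l → k ≡ toℕ l ℕ.+ u ℕ.* N) (≡.sym i≡j) k≡
        u<a : u ℕ.< a
        u<a = ℕ.*-cancelʳ-< N u a (ℕ.+-cancelˡ-< (toℕ i) _ _ (subst (ℕ._< toℕ i ℕ.+ a ℕ.* N) k≡′ k<))
        shuffle : toℕ i ℕ.+ u ℕ.* N ℕ.+ N ≡ toℕ i ℕ.+ suc u ℕ.* N
        shuffle = ≡.trans (ℕ.+-assoc (toℕ i) _ N) (≡.cong (toℕ i ℕ.+_) (ℕ.+-comm (u ℕ.* N) N))
        next : toℕ i ℕ.+ suc u ℕ.* N ℕ.≤ toℕ i ℕ.+ a ℕ.* N
        next = ℕ.+-monoʳ-≤ (toℕ i) (ℕ.*-monoˡ-≤ N u<a)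

    P^≉0 : ∀ a → ¬ P ^ a ≈ 0#
    P^≉0 zero    1≈0 = P∤1 (∣ʳ-respʳ-≈ (sym 1≈0) (P ∣0))
    P^≉0 (suc a) eq with noZeroDivisors P (P ^ a) eq
    ... | inj₁ P≈0  = P≉0 P≈0
    ... | inj₂ Pᵃ≈0 = P^≉0 a Pᵃ≈0

    record Integral (k : ℕ) : Set (c ⊔ ℓ) where
      field
        den≉0    : ¬ falling k (extend k) ≈ 0#
        integral : ∀ x → ∃ λ z → ∃ λ w → falling k x * w ≈ z * falling k (extend k) × ¬ P ∣ w

    integral-step : ∀ (i : Fin N) a → Integral a → Integral (toℕ i ℕ.+ a ℕ.* N)
    integral-step i a record { den≉0 = D≉0 ; integral = integral } = record
      { den≉0 = λ eq → nonzero (trans (sym den-eq) eq)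
      ; integral = λ x → quotient x
      }
      where
      k = toℕ i ℕ.+ a ℕ.* N
      D = falling a (extend a)
      module V = Split (splitting i (extend k) (extend a) (extend-step i a) k)
      V≡a : V.a ≡ a
      V≡a = ℕ.≤-antisym
        (ℕ.≤-pred (ℕ.*-cancelʳ-< N V.a (suc a) (ℕ.+-cancelˡ-< (toℕ i) _ _
          (subst (toℕ i ℕ.+ V.a ℕ.* N ℕ.<_)
            (≡.trans (ℕ.+-assoc (toℕ i) _ N) (≡.cong (toℕ i ℕ.+_) (ℕ.+-comm (a ℕ.* N) N))) V.upper))))
        (ℕ.*-cancelʳ-≤ a V.a N (ℕ.+-cancelˡ-≤ (toℕ i) _ _ V.lower))
      den-eq : falling k (extend k) ≈ V.U * (P ^ a * D)
      den-eq = subst (λ m → falling k (extend k) ≈ V.U * (P ^ m * falling m (extend a))) V≡a V.eq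
      nonzero : ¬ V.U * (P ^ a * D) ≈ 0#
      nonzero eq with noZeroDivisors V.U (P ^ a * D) eq
      ... | inj₁ U≈0 = V.P∤U (∣ʳ-respʳ-≈ (sym U≈0) (P ∣0))
      ... | inj₂ eq′ with noZeroDivisors (P ^ a) D eq′
      ...   | inj₁ Pᵃ≈0 = P^≉0 a Pᵃ≈0
      ...   | inj₂ D≈0  = D≉0 D≈0
      quotient : ∀ x → ∃ λ z → ∃ λ w → falling k x * w ≈ z * falling k (extend k) × ¬ P ∣ w
      quotient x with b-complete x
      ... | j , x≈bj with mod⇒≈+* x≈bj
      ...   | y , x≈bj+yP with splitting j x y (trans x≈bj+yP (+-congˡ (*-comm y P))) k | integral y
      ...     | split a′ U lower _ _ eq | z , w , Nw≈zD , P∤w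
              with falling-+ a (a′ ℕ.∸ a) y
      ...       | r , rest = U * P ^ m * r * z , V.U * w , (begin
        falling k x * (V.U * w)                             ≈⟨ *-congʳ eq ⟩
        U * (P ^ a′ * falling a′ y) * (V.U * w)             ≈⟨ *-congʳ (*-congˡ (*-cong power tail)) ⟩
        U * ((P ^ a * P ^ m) * (falling a y * r)) * (V.U * w)
          ≈⟨ solve 7 (λ U Pᵃ Pᵐ N r V w → U :* ((Pᵃ :* Pᵐ) :* (N :* r)) :* (V :* w) :=
                 (U :* Pᵐ :* r) :* (V :* Pᵃ) :* (N :* w))
               refl U (P ^ a) (P ^ m) (falling a y) r V.U w ⟩
        (U * P ^ m * r) * (V.U * P ^ a) * (falling a y * w) ≈⟨ *-congˡ Nw≈zD ⟩
        (U * P ^ m * r) * (V.U * P ^ a) * (z * D)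
          ≈⟨ solve 5 (λ T V Pᵃ z D → T :* (V :* Pᵃ) :* (z :* D) := (T :* z) :* (V :* (Pᵃ :* D)))
               refl (U * P ^ m * r) V.U (P ^ a) z D ⟩
        (U * P ^ m * r * z) * (V.U * (P ^ a * D))           ≈⟨ *-congˡ den-eq ⟨
        (U * P ^ m * r * z) * falling k (extend k)          ∎) , ∤-* V.P∤U P∤w
        where
        m = a′ ℕ.∸ a
        a≤a′ : a ℕ.≤ a′
        a≤a′ = ℕ.≤-pred (ℕ.*-cancelʳ-< N a (suc a′) (ℕ.≤-<-trans (ℕ.m≤n+m (a ℕ.* N) (toℕ i))
          (ℕ.≤-<-trans lower (ℕ.+-monoˡ-< (a′ ℕ.* N) (Fin.toℕ<n j)))))
        a′≡ : a′ ≡ a ℕ.+ m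
        a′≡ = ≡.sym (ℕ.m+[n∸m]≡n a≤a′)
        power : P ^ a′ ≈ P ^ a * P ^ m
        power = trans (^-congʳ P a′≡) (^-homo-* P a m)
        tail : falling a′ y ≈ falling a y * r
        tail = trans (reflexive (≡.cong (λ n → falling n y) a′≡)) rest

    abstract
      integral : ∀ k → Integral k
      integral = <-rec Integral go
        where
        1≉0 : ¬ 1# ≈ 0#
        1≉0 = P^≉0 0
        go : ∀ k → (∀ {j} → j ℕ.< k → Integral j) → Integral k
        go zero    _   = record
          { den≉0 = 1≉0
          ; integral = λ x → 1# , 1# , refl , P∤1
          }
        go (suc k) rec with suc k divMod N
        ... | result a i k≡ = subst Integral (≡.sym k≡) (integral-step i a (rec (smaller a k≡)))
          where
          smaller : ∀ a → suc k ≡ toℕ i ℕ.+ a ℕ.* N → a ℕ.< suc k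
          smaller zero    _  = s≤s z≤n
          smaller (suc a) eq = subst (suc a ℕ.<_) (≡.sym eq) (ℕ.<-≤-trans
            (ℕ.m<m*n (suc a) N 2≤N) (ℕ.m≤n+m (suc a ℕ.* N) (toℕ i)))

    -- The value at x of the polynomial ∏ⱼ (X - bⱼ) / ∏ⱼ (bₖ - bⱼ), with j < k
    -- in both products, as an element of the field of fractions.
    Q : ℕ → Carrier → Fraction
    Q k x = record
      { num   = product {k} λ j → x - extend (toℕ j)
      ; den   = product {k} λ j → extend k - extend (toℕ j)
      ; den≉0 = Integral.den≉0 (integral k)
      }

    Q-cong : ∀ k {x y} → x ≈ y → Q k x ≃ Q k y
    Q-cong k x≈y = *-congʳ (sum-cong-≋ {k} λ j → +-congʳ x≈y)
      where open MonoidSum *-monoid using (sum-cong-≋)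

    abstract
      Q-integral : ∀ k x → IntegralAt P (Q k x)
      Q-integral k x with Integral.integral (integral k) x
      ... | z , w , eq , P∤w =
        record { num = z ; den = w ; den≉0 = λ w≈0 → P∤w (∣ʳ-respʳ-≈ (sym w≈0) (P ∣0)) } , eq , P∤w

module BezoutIdentities (R : CommutativeRing c ℓ) where
  open CommutativeRing R
  open Congruence R
  open Coprimality R
  open SemiringDivisibility semiring using (_∣_; _,_)
  open SemiringSolver commutativeSemiring using (solve; _:=_; _:+_; _:*_)
  open SetoidReasoning setoid

  divisionStep : ∀ {P w r s u v} → P ≈ r + s * w → u * r + v * P ≈ 1# →
                 - (u * s) * w + (u + v) * P ≈ 1#
  divisionStep {P} {w} {r} {s} {u} {v} P≈r+sw ur+vP≈1 = begin
    - (u * s) * w + (u + v) * P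
      ≈⟨ solve 5 (λ z w u v P → z :* w :+ (u :+ v) :* P := z :* w :+ u :* P :+ v :* P) refl (- (u * s)) w u v P ⟩
    - (u * s) * w + u * P + v * P
      ≈⟨ +-congʳ (+-congˡ (*-congˡ P≈r+sw)) ⟩
    - (u * s) * w + u * (r + s * w) + v * P
      ≈⟨ solve 7 (λ z w u r s v P → z :* w :+ u :* (r :+ s :* w) :+ v :* P :=
             (z :+ u :* s) :* w :+ (u :* r :+ v :* P)) refl (- (u * s)) w u r s v P ⟩
    (- (u * s) + u * s) * w + (u * r + v * P)
      ≈⟨ +-cong (trans (*-congʳ (-‿inverseˡ (u * s))) (zeroˡ w)) ur+vP≈1 ⟩
    0# + 1#
      ≈⟨ +-identityˡ 1# ⟩
    1# ∎

  reductionStep : ∀ {P w r m u v} → w ≈ r + m * P → u * r + v * P ≈ 1# →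
                  u * w + (v + - (u * m)) * P ≈ 1#
  reductionStep {P} {w} {r} {m} {u} {v} w≈r+mP ur+vP≈1 = begin
    u * w + (v + - (u * m)) * P
      ≈⟨ +-congʳ (*-congˡ w≈r+mP) ⟩
    u * (r + m * P) + (v + - (u * m)) * P
      ≈⟨ solve 6 (λ u r m P v z → u :* (r :+ m :* P) :+ (v :+ z) :* P :=
             (z :+ u :* m) :* P :+ (u :* r :+ v :* P)) refl u r m P v (- (u * m)) ⟩
    (- (u * m) + u * m) * P + (u * r + v * P)
      ≈⟨ +-cong (trans (*-congʳ (-‿inverseˡ (u * m))) (zeroˡ P)) ur+vP≈1 ⟩
    0# + 1#
      ≈⟨ +-identityˡ 1# ⟩
    1# ∎

  unitStep : ∀ {P w r s} → P ≈ r + s * w → r ≈ 0# → P ≈ s * w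
  unitStep P≈r+sw r≈0 = trans P≈r+sw (trans (+-congʳ r≈0) (+-identityˡ _))

  cofactorUnit : ∀ {P w s t} → P ≈ s * w → t * s ≈ 1# → t * P ≈ w
  cofactorUnit {P} {w} {s} {t} P≈sw ts≈1 = begin
    t * P         ≈⟨ *-congˡ P≈sw ⟩
    t * (s * w)   ≈⟨ *-assoc t s w ⟨
    t * s * w     ≈⟨ *-congʳ ts≈1 ⟩
    1# * w        ≈⟨ *-identityˡ w ⟩
    w             ∎

  +0* : ∀ {x y z} → x ≈ y → x + 0# * z ≈ y
  +0* {z = z} x≈y = trans (+-congˡ (zeroˡ z)) (trans (+-identityʳ _) x≈y)

  bezout-mod : ∀ {P w r} → w ≈ r [mod P ] → Comaximal r P → Comaximal w P
  bezout-mod w≈r (u , v , eq) with mod⇒≈+* w≈r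
  ... | m , w≈r+mP = u , v + - (u * m) , reductionStep w≈r+mP eq

  comaximal⇒∣ : ∀ {P x y} → Comaximal x P → P ∣ x * y → P ∣ y
  comaximal⇒∣ {P} {x} {y} (u , v , ux+vP≈1) (m , mP≈xy) = u * m + y * v , (begin
    (u * m + y * v) * P          ≈⟨ solve 5 (λ u m y v P → (u :* m :+ y :* v) :* P := u :* (m :* P) :+ v :* P :* y) refl u m y v P ⟩
    u * (m * P) + v * P * y      ≈⟨ +-congʳ (*-congˡ mP≈xy) ⟩
    u * (x * y) + v * P * y      ≈⟨ solve 5 (λ u x y v P → u :* (x :* y) :+ v :* P :* y := (u :* x :+ v :* P) :* y) refl u x y v P ⟩
    (u * x + v * P) * y          ≈⟨ *-congʳ ux+vP≈1 ⟩
    1# * y                       ≈⟨ *-identityˡ y ⟩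
    y                            ∎)

-- A field with q elements. The apartness of a Heyting field is tight, and
-- on a finite field it is the negation of equality.
module FiniteField
  (F : HeytingField c ℓ₁ ℓ₂) (q : ℕ)
  (enumeration : Inverse (CommutativeRing.setoid (fieldRing F)) (≡.setoid (Fin q)))
  where

  private
    module F where
      open CommutativeRing (fieldRing F) public
      open RingProperties ring public using (x[y-z]≈xy-xz)
      open HeytingField F public using (#⇒invertible; invertible⇒#; tight; #-irrefl)

  private
    module Enumeration = Inverse enumeration

  infix 4 _≟_

  _≟_ : (a b : F.Carrier) → Dec (a F.≈ b)
  a ≟ b = Dec.map′
    (λ eq → F.trans (F.sym (Enumeration.strictlyInverseʳ a))
              (F.trans (Enumeration.from-cong eq) (Enumeration.strictlyInverseʳ b)))
    Enumeration.to-cong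
    (Enumeration.to a Fin.≟ Enumeration.to b)

  1≉0 : ¬ F.1# F.≈ F.0#
  1≉0 1≈0 = F.#-irrefl {F.0#} F.refl (F.invertible⇒# (F.0# , 0*a≈1 , a*0≈1))
    where
    0*a≈1 : F.0# F.* (F.0# F.- F.0#) F.≈ F.1#
    0*a≈1 = F.trans (F.zeroˡ _) (F.sym 1≈0)
    a*0≈1 : (F.0# F.- F.0#) F.* F.0# F.≈ F.1#
    a*0≈1 = F.trans (F.zeroʳ _) (F.sym 1≈0)

  inverse : ∀ a → ¬ a F.≈ F.0# → ∃ λ b → a F.* b F.≈ F.1#
  inverse a a≉0 with Fin.any? (λ i → a F.* Enumeration.from i ≟ F.1#)
  ... | yes (i , eq) = Enumeration.from i , eq
  ... | no noInverse = contradiction (proj₁ (F.tight a F.0#) λ a#0 → noInverse (found a#0)) a≉0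
    where
    found : HeytingField._#_ F a F.0# → ∃ λ i → a F.* Enumeration.from i F.≈ F.1#
    found a#0 with F.#⇒invertible a#0
    ... | b , _ , ab≈1 = Enumeration.to b ,
      F.trans (F.*-cong (F.sym (F.trans (F.+-congˡ -0≈0) (F.+-identityʳ a))) (Enumeration.strictlyInverseʳ b)) ab≈1
      where
      -0≈0 : F.- F.0# F.≈ F.0#
      -0≈0 = F.trans (F.sym (F.+-identityˡ _)) (F.-‿inverseʳ F.0#)

  2≤q : 2 ℕ.≤ q
  2≤q = atLeastTwo q ≡.refl
    where
    atLeastTwo : ∀ r → q ≡ r → 2 ℕ.≤ q
    atLeastTwo zero          q≡0 = contradiction (subst Fin q≡0 (Enumeration.to F.0#)) λ ()
    atLeastTwo (suc zero)    q≡1 = contradiction 1≈0 1≉0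
      where
      subsingleton : ∀ {r} → r ≡ 1 → (i j : Fin r) → i ≡ j
      subsingleton ≡.refl zero zero = ≡.refl
      1≈0 : F.1# F.≈ F.0#
      1≈0 = F.trans (F.sym (Enumeration.strictlyInverseʳ F.1#))
        (F.trans (Enumeration.from-cong (subsingleton q≡1 _ _)) (Enumeration.strictlyInverseʳ F.0#))
    atLeastTwo (suc (suc r)) q≡r = subst (2 ℕ.≤_) (≡.sym q≡r) (s≤s (s≤s z≤n))

  a*b≈0⇒b≈0 : ∀ {a b} → ¬ a F.≈ F.0# → a F.* b F.≈ F.0# → b F.≈ F.0#
  a*b≈0⇒b≈0 {a} {b} a≉0 ab≈0 with inverse a a≉0
  ... | a⁻¹ , aa⁻¹≈1 = begin
    b                      ≈⟨ F.*-identityˡ b ⟨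
    F.1# F.* b             ≈⟨ F.*-congʳ aa⁻¹≈1 ⟨
    (a F.* a⁻¹) F.* b      ≈⟨ F.*-congʳ (F.*-comm a a⁻¹) ⟩
    (a⁻¹ F.* a) F.* b      ≈⟨ F.*-assoc a⁻¹ a b ⟩
    a⁻¹ F.* (a F.* b)      ≈⟨ F.*-congˡ ab≈0 ⟩
    a⁻¹ F.* F.0#           ≈⟨ F.zeroʳ a⁻¹ ⟩
    F.0#                   ∎
    where open SetoidReasoning F.setoid

  open Polynomials (fieldRing F) public
    using (coeff; coeffwise; at; _·_; coeff-+; coeff-neg; coeff-·; ∷-cong; 0∷[]≈[]; deg_<_; deg_≡_)

  𝔸 : CommutativeRing c ℓ₁
  𝔸 = Polynomials.ring (fieldRing F)

  open CommutativeRing 𝔸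
  open SemiringDivisibility semiring using (_∣_; _,_; _∣0; ∣ʳ-respʳ-≈)
  open Congruence 𝔸

  deg-[] : ∀ n → deg [] < n
  deg-[] n i n≤i = F.refl

  deg-cong : ∀ {g h n} → g ≈ h → deg g < n → deg h < n
  deg-cong g≈h deg<n i n≤i = F.trans (F.sym (at g≈h i)) (deg<n i n≤i)

  deg<0⇒≈0 : ∀ {h} → deg h < 0 → h ≈ 0#
  deg<0⇒≈0 deg<0 = coeffwise λ i → deg<0 i z≤n

  deg-weaken : ∀ {h m n} → m ℕ.≤ n → deg h < m → deg h < n
  deg-weaken m≤n deg<m i n≤i = deg<m i (ℕ.≤-trans m≤n n≤i)

  deg-sub : ∀ {g h n} → deg g < n → deg h < n → deg (g - h) < n
  deg-sub {g} {h} deg-g deg-h i n≤i = begin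
    coeff (g - h) i                  ≈⟨ coeff-+ g (- h) i ⟩
    coeff g i F.+ coeff (- h) i      ≈⟨ F.+-cong (deg-g i n≤i) (coeff-neg h i) ⟩
    F.0# F.+ F.- coeff h i           ≈⟨ F.+-congˡ (F.-‿cong (deg-h i n≤i)) ⟩
    F.0# F.+ F.- F.0#                ≈⟨ F.-‿inverseʳ F.0# ⟩
    F.0#                             ∎
    where open SetoidReasoning F.setoid

  degree : ∀ h → h ≈ 0# ⊎ ∃ λ n → deg h ≡ n
  degree []      = inj₁ refl
  degree (a ∷ h) with degree h
  ... | inj₂ (n , h≉0 , deg-h) = inj₂ (suc n , h≉0 , λ { (suc i) (s≤s n≤i) → deg-h i n≤i })
  ... | inj₁ h≈0 with a ≟ F.0#
  ...   | yes a≈0 = inj₁ (trans (∷-cong a≈0 h≈0) 0∷[]≈[])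
  ...   | no  a≉0 = inj₂ (0 , a≉0 , λ { (suc i) _ → at h≈0 i })

  ≈0? : ∀ h → Dec (h ≈ 0#)
  ≈0? h with degree h
  ... | inj₁ h≈0             = yes h≈0
  ... | inj₂ (n , h≉0 , _)   = no λ h≈0 → h≉0 (at h≈0 n)

  coeff-*-top : ∀ g h m n → deg g < suc m → deg h < suc n →
                coeff (g * h) (m ℕ.+ n) F.≈ coeff g m F.* coeff h n
  coeff-*-top []      h m n _ _ = F.sym (F.zeroˡ _)
  coeff-*-top (a ∷ g) h zero n deg-g deg-h = begin
    coeff (a · h + (F.0# ∷ g * h)) n              ≈⟨ coeff-+ (a · h) (F.0# ∷ g * h) n ⟩
    coeff (a · h) n F.+ coeff (F.0# ∷ g * h) n    ≈⟨ F.+-cong (coeff-· a h n) (at g*h≈0 n) ⟩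
    a F.* coeff h n F.+ F.0#                      ≈⟨ F.+-identityʳ _ ⟩
    a F.* coeff h n                               ∎
    where
    open SetoidReasoning F.setoid
    g≈0 : g ≈ 0#
    g≈0 = coeffwise λ i → deg-g (suc i) (s≤s z≤n)
    g*h≈0 : F.0# ∷ g * h ≈ 0#
    g*h≈0 = trans (∷-cong F.refl (*-congʳ {h} {g} {0#} g≈0)) 0∷[]≈[]
  coeff-*-top (a ∷ g) h (suc m) n deg-g deg-h = begin
    coeff (a · h + (F.0# ∷ g * h)) (suc m ℕ.+ n)
      ≈⟨ coeff-+ (a · h) (F.0# ∷ g * h) (suc m ℕ.+ n) ⟩
    coeff (a · h) (suc m ℕ.+ n) F.+ coeff (g * h) (m ℕ.+ n)
      ≈⟨ F.+-cong (F.trans (coeff-· a h (suc m ℕ.+ n)) (F.*-congˡ (deg-h _ (s≤s (ℕ.m≤n+m n m)))))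
           (coeff-*-top g h m n (λ i m≤i → deg-g (suc i) (s≤s m≤i)) deg-h) ⟩
    a F.* F.0# F.+ coeff g m F.* coeff h n
      ≈⟨ F.+-congʳ (F.zeroʳ a) ⟩
    F.0# F.+ coeff g m F.* coeff h n
      ≈⟨ F.+-identityˡ _ ⟩
    coeff g m F.* coeff h n ∎
    where open SetoidReasoning F.setoid

  coeff-*-top≉0 : ∀ {g h m n} → deg g ≡ m → deg h ≡ n → ¬ coeff (g * h) (m ℕ.+ n) F.≈ F.0#
  coeff-*-top≉0 {g} {h} {m} {n} (g≉0 , deg-g) (h≉0 , deg-h) eq =
    h≉0 (a*b≈0⇒b≈0 g≉0 (F.trans (F.sym (coeff-*-top g h m n deg-g deg-h)) eq))

  *-noZeroDivisors : ∀ g h → g * h ≈ 0# → g ≈ 0# ⊎ h ≈ 0#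
  *-noZeroDivisors g h gh≈0 with degree g | degree h
  ... | inj₁ g≈0          | _                 = inj₁ g≈0
  ... | inj₂ _            | inj₁ h≈0          = inj₂ h≈0
  ... | inj₂ (m , deg-g)  | inj₂ (n , deg-h)  =
    contradiction (at gh≈0 (m ℕ.+ n)) (coeff-*-top≉0 {g} {h} deg-g deg-h)

  module Division (f : Carrier) (n : ℕ) (deg-f : deg f ≡ n) where

    private
      lc⁻¹ : F.Carrier
      lc⁻¹ = proj₁ (inverse (coeff f n) (proj₁ deg-f))

      factor : Carrier → F.Carrier
      factor h = coeff h n F.* lc⁻¹

      -- Subtracts the multiple of f that clears the coefficient of degree n.
      step : Carrier → Carrier
      step h = h - factor h · f

    _rem : Carrier → Carrier
    [] rem      = []
    (a ∷ h) rem = step (a ∷ h rem)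

    private
      coeff-step : ∀ h i → coeff (step h) i F.≈ coeff h i F.- factor h F.* coeff f i
      coeff-step h i = F.trans (coeff-+ h _ i)
        (F.+-congˡ (F.trans (coeff-neg (factor h · f) i) (F.-‿cong (coeff-· (factor h) f i))))

      step-deg : ∀ h → deg h < suc n → deg (step h) < n
      step-deg h deg-h i n≤i with n ℕ.≟ i
      ... | yes ≡.refl = begin
        coeff (step h) n                                    ≈⟨ coeff-step h n ⟩
        coeff h n F.- coeff h n F.* lc⁻¹ F.* coeff f n      ≈⟨ F.+-congˡ (F.-‿cong (F.*-assoc _ _ _)) ⟩
        coeff h n F.- coeff h n F.* (lc⁻¹ F.* coeff f n)    ≈⟨ F.+-congˡ (F.-‿cong (F.*-congˡ lc⁻¹lc≈1)) ⟩
        coeff h n F.- coeff h n F.* F.1#                    ≈⟨ F.+-congˡ (F.-‿cong (F.*-identityʳ _)) ⟩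
        coeff h n F.- coeff h n                             ≈⟨ F.-‿inverseʳ _ ⟩
        F.0#                                                ∎
        where
        open SetoidReasoning F.setoid
        lc⁻¹lc≈1 : lc⁻¹ F.* coeff f n F.≈ F.1#
        lc⁻¹lc≈1 = F.trans (F.*-comm _ _) (proj₂ (inverse (coeff f n) (proj₁ deg-f)))
      ... | no n≢i = begin
        coeff (step h) i                       ≈⟨ coeff-step h i ⟩
        coeff h i F.- factor h F.* coeff f i   ≈⟨ F.+-cong (deg-h i n<i) (F.-‿cong (F.*-congˡ (proj₂ deg-f i n<i))) ⟩
        F.0# F.- factor h F.* F.0#             ≈⟨ F.+-congˡ (F.-‿cong (F.zeroʳ _)) ⟩
        F.0# F.- F.0#                          ≈⟨ F.-‿inverseʳ _ ⟩
        F.0#                                   ∎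
        where
        open SetoidReasoning F.setoid
        n<i : n ℕ.< i
        n<i = ℕ.≤∧≢⇒< n≤i n≢i

    rem-deg : ∀ h → deg (h rem) < n
    rem-deg []      = deg-[] n
    rem-deg (a ∷ h) = step-deg (a ∷ h rem) λ { (suc i) (s≤s n≤i) → rem-deg h i n≤i }

    private
      ·≈* : ∀ a h → a · h ≈ (a ∷ []) * h
      ·≈* a h = sym (trans
        (+-congˡ {a · h} 0∷[]≈[]) (+-identityʳ (a · h)))

      shift-* : ∀ g h → (F.0# ∷ g) * h ≈ F.0# ∷ g * h
      shift-* g h = +-congʳ {F.0# ∷ g * h} {F.0# · h} {[]}
        (coeffwise λ i → F.trans (coeff-· F.0# h i) (F.zeroˡ _))

      step-mod : ∀ h → h ≈ step h [mod f ]
      step-mod h = ≈+*⇒mod (factor h ∷ []) (begin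
        h                                            ≈⟨ +-identityʳ h ⟨
        h + 0#                                       ≈⟨ +-congˡ (-‿inverseˡ (factor h · f)) ⟨
        h + (- (factor h · f) + factor h · f)        ≈⟨ +-assoc h _ _ ⟨
        step h + factor h · f                        ≈⟨ +-congˡ (·≈* (factor h) f) ⟩
        step h + (factor h ∷ []) * f                 ∎)
        where open SetoidReasoning setoid

    rem-mod : ∀ h → h ≈ h rem [mod f ]
    rem-mod []      = ≈⇒mod refl
    rem-mod (a ∷ h) = mod-trans shifted (step-mod (a ∷ h rem))
      where
      open SetoidReasoning setoid
      shifted : a ∷ h ≈ a ∷ h rem [mod f ]
      shifted with mod⇒≈+* (rem-mod h)
      ... | m , eq = ≈+*⇒mod (F.0# ∷ m) (begin
        a ∷ h                              ≈⟨ ∷-cong (F.sym (F.+-identityʳ a)) eq ⟩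
        (a ∷ h rem) + (F.0# ∷ m * f)       ≈⟨ +-congˡ {a ∷ h rem} (shift-* m f) ⟨
        (a ∷ h rem) + (F.0# ∷ m) * f       ∎)

    ∣∧deg<⇒≈0 : ∀ {h} → f ∣ h → deg h < n → h ≈ 0#
    ∣∧deg<⇒≈0 {h} (m , mf≈h) deg-h with degree m
    ... | inj₁ m≈0 = begin
      h         ≈⟨ mf≈h ⟨
      m * f     ≈⟨ *-congʳ m≈0 ⟩
      0# * f    ≈⟨ zeroˡ f ⟩
      0#        ∎
      where open SetoidReasoning setoid
    ... | inj₂ (k , deg-m) = contradiction
      (F.trans (at mf≈h (k ℕ.+ n)) (deg-h (k ℕ.+ n) (ℕ.m≤n+m n k)))
      (coeff-*-top≉0 {m} {f} deg-m deg-f)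

    deg<∧mod⇒≈ : ∀ {g h} → deg g < n → deg h < n → g ≈ h [mod f ] → g ≈ h
    deg<∧mod⇒≈ {g} {h} deg-g deg-h g≈h =
      x∙y⁻¹≈ε⇒x≈y g h (∣∧deg<⇒≈0 (divides g≈h) (deg-sub {g} {h} deg-g deg-h))
      where open AbelianGroupProperties +-abelianGroup using (x∙y⁻¹≈ε⇒x≈y)

    rem-cong : ∀ {g h} → g ≈ h [mod f ] → g rem ≈ h rem
    rem-cong {g} {h} g≈h = deg<∧mod⇒≈ (rem-deg g) (rem-deg h)
      (mod-trans (mod-sym (rem-mod g)) (mod-trans g≈h (rem-mod h)))

    ∣? : ∀ h → Dec (f ∣ h)
    ∣? h = Dec.map′
      (λ r≈0 → ≈0⇒∣ (mod-trans (rem-mod h) (≈⇒mod r≈0)))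
      (λ f∣h → rem-cong {h} {0#} (∣⇒≈0 f∣h))
      (≈0? (h rem))

  open RawSemiringDefinitions (Semiring.rawSemiring semiring) public using (Irreducible; Prime)
  open RawSemiringDefinitions (Semiring.rawSemiring semiring) using (product)
  open Exponentiation semiring public using (_^_)
  open Fractions 𝔸 public

  module Bezout (P : Carrier) (d : ℕ) (deg-P : deg P ≡ d) (irreducible : Irreducible P) where
    open Irreducible irreducible using (p∤1; split-∣1)
    open Coprimality 𝔸
    open BezoutIdentities 𝔸

    private
      module P = Division P d deg-P

    bezout-below : ∀ m → m ℕ.≤ d → ∀ w → ¬ w ≈ 0# → deg w < m → Comaximal w P
    bezout-below zero    _    w w≉0 deg-w = contradiction (deg<0⇒≈0 deg-w) w≉0
    bezout-below (suc m) m<d  w w≉0 deg-w with degree w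
    ... | inj₁ w≈0 = contradiction w≈0 w≉0
    ... | inj₂ (k , deg-w≡k) = reduced (≈0? r) (mod⇒≈+* (W.rem-mod P))
      where
      module W = Division w k deg-w≡k
      r : Carrier
      r = P W.rem
      k≤m : k ℕ.≤ m
      k≤m = ℕ.≮⇒≥ λ m<k → proj₁ deg-w≡k (deg-w k m<k)
      reduced : Dec (r ≈ 0#) → (∃ λ s → P ≈ r + s * w) → Comaximal w P
      reduced (yes r≈0) (s , P≈r+sw) with split-∣1 {s} {w} (unitStep {P} {w} {r} {s} P≈r+sw r≈0)
      ... | inj₂ (u , uw≈1) = u , 0# , +0* {u * w} {1#} {P} uw≈1
      ... | inj₁ (t , ts≈1) = contradiction
        (P.∣∧deg<⇒≈0 (t , cofactorUnit {P} {w} {s} {t} (unitStep {P} {w} {r} {s} P≈r+sw r≈0) ts≈1)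
          (deg-weaken {w} m<d deg-w)) w≉0
      reduced (no r≉0) (s , P≈r+sw)
        with bezout-below m (ℕ.≤-trans (ℕ.n≤1+n m) m<d) r r≉0 (deg-weaken {r} k≤m (W.rem-deg P))
      ... | u , v , ur+vP≈1 = - (u * s) , u + v , divisionStep {P} {w} {r} {s} {u} {v} P≈r+sw ur+vP≈1

    abstract
      bezout : BezoutAt P
      bezout w P∤w = bezout-mod {P} {w} {w P.rem} (P.rem-mod w) (bezout-below d ℕ.≤-refl (w P.rem)
        (λ r≈0 → P∤w (≈0⇒∣ (mod-trans (P.rem-mod w) (≈⇒mod r≈0)))) (P.rem-deg w))

    prime : Prime P
    prime = record
      { p≉0     = λ P≈0 → proj₁ deg-P (at P≈0 d)
      ; p∤1     = p∤1
      ; split-∣ = λ {x} {y} P∣xy → split x y P∣xy (P.∣? x)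
      }
      where
      split : ∀ x y → P ∣ x * y → Dec (P ∣ x) → P ∣ x ⊎ P ∣ y
      split x y P∣xy (yes P∣x) = inj₁ P∣x
      split x y P∣xy (no P∤x)  = inj₂ (comaximal⇒∣ {P} {x} {y} (bezout x P∤x) P∣xy)

  record Ordering (d : ℕ) : Set (c ⊔ ℓ₁) where
    field
      b          : Fin (q ℕ.^ d) → Carrier
      b-deg      : ∀ i → deg (b i) < d
      injective  : ∀ i j → b i ≈ b j → i ≡ j
      surjective : ∀ h → deg h < d → ∃ λ i → b i ≈ h
      b₀≈0       : ∀ i → toℕ i ≡ 0 → b i ≈ 0#
      b₁≈1       : ∀ i → toℕ i ≡ 1 → b i ≈ 1#
      monotone   : ∀ i j → 1 ℕ.≤ toℕ i → toℕ i ℕ.≤ toℕ j →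
                   ∀ m n → deg (b i) ≡ m → deg (b j) ≡ n → m ℕ.≤ n

  module Wagner
    (P : Carrier) (d : ℕ) (deg-P : deg P ≡ d) (1≤d : 1 ℕ.≤ d)
    (irreducible : Irreducible P) (ordering : Ordering d)
    where

    private
      2≤qᵈ : 2 ℕ.≤ q ℕ.^ d
      2≤qᵈ = ℕ.≤-trans 2≤q (ℕ.≤-trans (ℕ.≤-reflexive (≡.sym (ℕ.^-identityʳ q)))
        (ℕ.^-monoʳ-≤ q {{ℕ.>-nonZero (ℕ.≤-trans (s≤s z≤n) 2≤q)}} 1≤d))

      module P = Division P d deg-P
      module O = Ordering ordering

    open Bezout P d deg-P irreducible using (bezout; prime)
    open Reduction 𝔸 *-noZeroDivisors P bezout public
    open NewtonBasis 𝔸 P (q ℕ.^ d) 2≤qᵈ O.b public renaming (extend to b)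

    completeResidues : CompleteResidues
    completeResidues = record
      { b-zero     = O.b₀≈0
      ; b-distinct = λ i j bi≈bj → O.injective i j (P.deg<∧mod⇒≈ (O.b-deg i) (O.b-deg j) bi≈bj)
      ; b-complete = λ x → let i , bi≈r = O.surjective (x P.rem) (P.rem-deg x) in
          i , mod-trans (P.rem-mod x) (≈⇒mod (sym bi≈r))
      }

    open Integrality *-noZeroDivisors prime completeResidues public

    -- h rem is the representative of degree less than deg f of the class of h.
    B : ∀ f n → deg f ≡ n → (e k : ℕ) →
        Func (CommutativeRing.setoid (𝔸 / f)) (CommutativeRing.setoid (𝔸 / (P ^ e)))
    B f n deg-f e k = record
      { to   = λ h → reduce e (Q k (h rem)) (Q-integral k (h rem))
      ; cong = λ {g} {h} g≈h → reduce-cong e (Q k (g rem)) (Q k (h rem))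
          (Q-integral k (g rem)) (Q-integral k (h rem)) (Q-cong k (rem-cong g≈h))
      }
      where open Division f n deg-f using (_rem; rem-cong)

  -- The values of σ are classes modulo g; for h dividing g, their congruence
  -- modulo h does not depend on the representatives.
  CongruencePreserving : ∀ f n → deg f ≡ n → ∀ g →
    Func (CommutativeRing.setoid (𝔸 / f)) (CommutativeRing.setoid (𝔸 / g)) → Set (c ⊔ ℓ₁)
  CongruencePreserving f n _ g σ = ∀ h₁ h₂ → deg h₁ < n → deg h₂ < n →
    ∀ h → h ∣ g → h₁ ≈ h₂ [mod h ] → (σ ⟨$⟩ h₁) ≈ (σ ⟨$⟩ h₂) [mod h ]

IsPrimePower : ℕ → Set
IsPrimePower q = ∃ λ p → ∃ λ m → ℕ.Prime p × 1 ℕ.≤ m × q ≡ p ℕ.^ m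

-- The greatest m ≤ bound with q ^ (d * m) ≤ k, or 0.
μ-below : (q d k bound : ℕ) → ℕ
μ-below q d k zero        = 0
μ-below q d k (suc bound) with q ℕ.^ (d ℕ.* suc bound) ℕ.≤? k
... | yes _ = suc bound
... | no  _ = μ-below q d k bound

-- ⌊log_q k / d⌋ for k ≥ 1, as the greatest m with q ^ (d * m) ≤ k.
μ : (q d k : ℕ) → ℕ
μ q d k = μ-below q d k k

μ-lower : ∀ q d k → 1 ℕ.≤ k → q ℕ.^ (d ℕ.* μ q d k) ℕ.≤ k
μ-lower q d k 1≤k = below k
  where
  below : ∀ m → q ℕ.^ (d ℕ.* μ-below q d k m) ℕ.≤ k
  below zero = ℕ.≤-trans (ℕ.≤-reflexive (≡.cong (q ℕ.^_) (ℕ.*-zeroʳ d))) 1≤k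
  below (suc m) with q ℕ.^ (d ℕ.* suc m) ℕ.≤? k
  ... | yes le = le
  ... | no  _  = below m

μ-greatest : ∀ q d k → 2 ℕ.≤ q → 1 ℕ.≤ d → ∀ m → q ℕ.^ (d ℕ.* m) ℕ.≤ k → m ℕ.≤ μ q d k
μ-greatest q d k 2≤q 1≤d m le = below k (ℕ.≤-trans m≤ le)
  where
  m<2^m : ∀ m → m ℕ.< 2 ℕ.^ m
  m<2^m zero    = s≤s z≤n
  m<2^m (suc m) = ℕ.+-mono-≤ (ℕ.≤-trans (s≤s z≤n) (m<2^m m))
    (ℕ.≤-trans (m<2^m m) (ℕ.≤-reflexive (≡.sym (ℕ.+-identityʳ _))))
  m≤ : m ℕ.≤ q ℕ.^ (d ℕ.* m)
  m≤ = ℕ.≤-trans (ℕ.<⇒≤ (m<2^m m)) (ℕ.≤-trans (ℕ.^-monoˡ-≤ m 2≤q)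
    (ℕ.^-monoʳ-≤ q {{ℕ.>-nonZero (ℕ.≤-trans (s≤s z≤n) 2≤q)}}
      (ℕ.≤-trans (ℕ.≤-reflexive (≡.sym (ℕ.*-identityˡ m))) (ℕ.*-monoˡ-≤ m 1≤d))))
  below : ∀ n → m ℕ.≤ n → m ℕ.≤ μ-below q d k n
  below zero    m≤0 = m≤0
  below (suc n) m≤1+n with q ℕ.^ (d ℕ.* suc n) ℕ.≤? k
  ... | yes _ = m≤1+n
  ... | no ¬le = below n (ℕ.≤-pred (ℕ.≤∧≢⇒< m≤1+n λ { ≡.refl → ¬le le }))

{-# OPTIONS --safe #-}
-- The matrix (Q_k(b_j)) is unitriangular and b_0, …, b_{qⁿ-1} are the polynomials
-- of degree less than n, so every σ has a unique expansion Σ c_k B_k. Splitting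
-- off the last base-qᵈ digit of k shows that x ≡ y modulo P^(s+r) implies
-- Q_k(x) ≡ Q_k(y) modulo P^r whenever k < q^(d(s+1)). Hence c_k B_k is congruence
-- preserving if P^μ(k) divides c_k. Conversely, comparing σ at b_k and at b_k′,
-- where k′ is k without its leading digit, isolates c_k modulo P^μ(k), by
-- induction on k.
module Submission where

open import Defs
open import Algebra.Apartness.Bundles using (HeytingField)
open import Algebra.Bundles using (CommutativeRing; Group; Semiring)
import Algebra.Definitions.RawSemiring as RawSemiringDefinitions
import Algebra.Properties.AbelianGroup as AbelianGroupProperties
import Algebra.Properties.Group as GroupProperties
import Algebra.Properties.Monoid.Sum as MonoidSum
import Algebra.Properties.Semiring.Divisibility as SemiringDivisibility
import Algebra.Properties.Semiring.Exp as Exponentiation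
import Algebra.Solver.Ring.NaturalCoefficients.Default as SemiringSolver
open import Data.Digit using (toDigits)
open import Data.Fin.Base as Fin using (Fin; zero; suc; toℕ; fromℕ<; combine; remQuot)
open import Data.Fin.Induction using (<-wellFounded)
import Data.Fin.Properties as Fin
open import Data.List.Base using ([]; _∷_)
open import Data.Nat.Base as ℕ using (ℕ; zero; suc; z≤n; s≤s; _≤_)
open import Data.Nat.DivMod using (_divMod_; result)
open import Data.Nat.Induction using (<-rec)
import Data.Nat.Properties as ℕ
open import Data.Product.Base using (∃; _×_; _,_; proj₁; proj₂)
open import Data.Product using (∃!)
open import Data.Sum.Base using (inj₁; inj₂)
open import Data.Vec.Functional as Vec using (Vector)
import Data.Vec.Functional.Relation.Binary.Equality.Setoid as VectorEquality
open import Function.Base using (_∘_)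
open import Function.Bundles using (Func; Inverse; _⟨$⟩_; _⇔_; mk⇔)
open import Induction.WellFounded using (Acc; acc)
open import Level using (Level; _⊔_)
open import Relation.Binary.Definitions using (tri<; tri≈; tri>)
open import Relation.Binary.PropositionalEquality as ≡ using (_≡_; _≢_; subst)
import Relation.Binary.Reasoning.Setoid as SetoidReasoning
open import Relation.Nullary.Decidable as Dec using (Dec; yes; no)
open import Relation.Nullary.Negation using (¬_; contradiction)

-- The residue of `Q k x` is computed with a denominator that depends on `x`, so the residues at two
-- points cannot be compared directly. Both quotients are first given a common denominator prime to
-- `P`, and congruences are proved for the numerators. Let N = q^d, k = i + aN and x = b_j + Py. Up
-- to factors prime to `P`, the numerator of Q_k(x) is P^a′ times the product of y - b_l over l <
-- a′, with a′ ≥ a, and the denominator is P^a times that of Q_a. Thus Q_k(x) is Q_a(y) times a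
-- factor that loses no precision: either a′ = a and nothing depending on y is left over, or a spare
-- `P` makes up for y being known to one power less than x. The loss comes only from passing to y in
-- Q_a, one power per digit, and the step that reaches a = 0 is free because Q_0 = 1. Hence s powers
-- are lost for k < N^(s+1), and μ(k) is the number of digits of k above the lowest. In the residue
-- ring, divisibility by P^s is visible only up to P^e, whence the exponents `s ⊓ e`.

private variable
  c ℓ ℓ₁ ℓ₂ : Level

-- Isolating a term of a sum; unitriangular systems.

module _ (G : Group c ℓ) where
  open Group G
  open GroupProperties G using (∙-cancelˡ; ∙-cancelʳ)
  open MonoidSum monoid using (sum; sum-cong-≋)

  -- Meant for congruence modulo `P ^ i` as the equality of the group: it singles out the `k`-th
  -- coefficient from two congruent expansions.
  sum-isolate : ∀ {n} {u v : Vector Carrier n} k → (∀ j → j ≢ k → u j ≈ v j) →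
                sum u ≈ sum v → u k ≈ v k
  sum-isolate {suc n} {u} {v} zero    u≈v eq = ∙-cancelʳ (sum (v ∘ suc)) _ _
    (trans (∙-congˡ (sym (sum-cong-≋ λ j → u≈v (suc j) λ ()))) eq)
  sum-isolate {suc n} {u} {v} (suc k) u≈v eq = sum-isolate k
    (λ j j≢k → u≈v (suc j) (j≢k ∘ Fin.suc-injective))
    (∙-cancelˡ (v zero) _ _ (trans (∙-congʳ (sym (u≈v zero λ ()))) eq))

module _ (R : CommutativeRing c ℓ) where
  open CommutativeRing R hiding (zero)
  open MonoidSum +-monoid using (sum; sum-cong-≋; sum-replicate-zero)
  open VectorEquality setoid using (_≋_)
  open AbelianGroupProperties +-abelianGroup using (//-rightDividesˡ; xyx⁻¹≈y)
  open SetoidReasoning setoid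

  -- Forward substitution: equation 0 forces `x 0 = s 0`, and moving its contribution to the left
  -- leaves a system of the same shape with both indices raised by one. Matrix and values are
  -- indexed by `ℕ` so that this shift needs no casts.
  unitriangular-∃! : ∀ n (a : ℕ → ℕ → Carrier) → (∀ k → a k k ≈ 1#) →
    (∀ {j k} → j ℕ.< k → a k j ≈ 0#) → (s : ℕ → Carrier) →
    ∃! _≋_ λ (x : Vector Carrier n) →
      ∀ (j : Fin n) → s (toℕ j) ≈ sum (λ k → x k * a (toℕ k) (toℕ j))
  unitriangular-∃! zero    a diag upper s = (λ ()) , (λ ()) , λ _ ()
  unitriangular-∃! (suc n) a diag upper s
    with unitriangular-∃! n (λ k j → a (suc k) (suc j)) (diag ∘ suc) (upper ∘ s≤s)
           (λ j → s (suc j) - s 0 * a 0 (suc j))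
  ... | x , solves , unique = s 0 Vec.∷ x , solves′ , λ {y} → unique′ y
    where
    row₀ : ∀ (y : Vector Carrier (suc n)) → sum (λ k → y k * a (toℕ k) 0) ≈ y zero
    row₀ y = begin
      y zero * a 0 0 + sum (λ k → y (suc k) * a (suc (toℕ k)) 0)
        ≈⟨ +-cong (trans (*-congˡ (diag 0)) (*-identityʳ _))
             (trans (sum-cong-≋ {n} λ k → trans (*-congˡ {y (suc k)} (upper (s≤s z≤n))) (zeroʳ _))
               (sum-replicate-zero n)) ⟩
      y zero + 0#   ≈⟨ +-identityʳ _ ⟩
      y zero        ∎
    solves′ : ∀ j → s (toℕ j) ≈ sum (λ k → (s 0 Vec.∷ x) k * a (toℕ k) (toℕ j))
    solves′ zero    = sym (row₀ (s 0 Vec.∷ x))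
    solves′ (suc j) = begin
      s (suc (toℕ j))                       ≈⟨ //-rightDividesˡ t _ ⟨
      (s (suc (toℕ j)) - t) + t             ≈⟨ +-comm _ _ ⟩
      t + (s (suc (toℕ j)) - t)             ≈⟨ +-congˡ (solves j) ⟩
      t + sum (λ k → x k * a (suc (toℕ k)) (suc (toℕ j))) ∎
      where t = s 0 * a 0 (suc (toℕ j))
    unique′ : ∀ y → (∀ j → s (toℕ j) ≈ sum (λ k → y k * a (toℕ k) (toℕ j))) → (s 0 Vec.∷ x) ≋ y
    unique′ y solves-y zero    = trans (solves-y zero) (row₀ y)
    unique′ y solves-y (suc k) = unique (λ j → trans
      (+-cong (solves-y (suc j)) (-‿cong (*-congʳ (unique′ y solves-y zero)))) (xyx⁻¹≈y _ _)) k

-- Congruences between values of the Newton quotients.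

module NewtonCongruence
  (R : CommutativeRing c ℓ) (P : CommutativeRing.Carrier R)
  (N : ℕ) (2≤N : 2 ℕ.≤ N) (b : Fin N → CommutativeRing.Carrier R)
  (noZeroDivisors : NoZeroDivisors R)
  (prime : RawSemiringDefinitions.Prime (Semiring.rawSemiring (CommutativeRing.semiring R)) P)
  (bezout : Coprimality.BezoutAt R P)
  (residues : NewtonBasis.CompleteResidues R P N 2≤N b)
  where

  open CommutativeRing R hiding (zero)
  open Congruence R
  open RawSemiringDefinitions.Prime prime using (p≉0; p∤1; split-∣)
  open NewtonBasis R P N 2≤N b
  open CompleteResidues residues using (b-complete)
  open Integrality noZeroDivisors prime residues
  open Reduction R noZeroDivisors P bezout
  open Exponentiation semiring using (_^_; ^-homo-*; ^-congʳ)
  open SemiringDivisibility semiring using (_∣_; _,_; ∣ʳ-trans)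
  open SemiringSolver commutativeSemiring using (solve; _:=_; _:+_; _:*_)
  open SetoidReasoning setoid

  private variable
    g x x′ y y′ : Carrier

  P^-∣ : ∀ {i j} → i ≤ j → P ^ i ∣ P ^ j
  P^-∣ {i} {j} i≤j = P ^ (j ℕ.∸ i) , trans (sym (^-homo-* P (j ℕ.∸ i) i))
    (^-congʳ P (ℕ.m∸n+n≡m i≤j))

  mod-∣ : ∀ {h} → h ∣ g → x ≈ y [mod g ] → x ≈ y [mod h ]
  mod-∣ h∣g x≈y = congruent (∣ʳ-trans h∣g (divides x≈y))

  mod-refl : x ≈ x [mod g ]
  mod-refl = ≈⇒mod refl

  falling-+-cong : ∀ k m → x ≈ x′ [mod g ] →
    proj₁ (falling-+ k m x) ≈ proj₁ (falling-+ k m x′) [mod g ]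
  falling-+-cong k zero    x≈x′ = mod-refl
  falling-+-cong k (suc m) x≈x′ =
    mod-*-cong (falling-+-cong k m x≈x′) (mod-+-cong x≈x′ mod-refl)

  -- Which factors `x - extend l` supply a `P` is decided by `k`, `i` and the count so far, never by
  -- `x`. Both splittings therefore proceed in step, and `U` is a product of congruent factors.
  splitting-cong : ∀ i (x≈ : x ≈ b i + P * y) (x′≈ : x′ ≈ b i + P * y′) k → x ≈ x′ [mod g ] →
    let module S  = Split (splitting i x y x≈ k)
        module S′ = Split (splitting i x′ y′ x′≈ k)
    in S.a ≡ S′.a × (S.U ≈ S′.U [mod g ])
  splitting-cong i x≈ x′≈ zero x≈x′ = ≡.refl , mod-refl
  splitting-cong {x} {y} {x′} {y′} i x≈ x′≈ (suc k) x≈x′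
    with splitting i x y x≈ k | splitting i x′ y′ x′≈ k | splitting-cong i x≈ x′≈ k x≈x′
  ... | split a U _ _ _ _ | split .a U′ _ _ _ _ | ≡.refl , U≈U′ with k ℕ.≟ toℕ i ℕ.+ a ℕ.* N
  ...   | yes _ = ≡.refl , U≈U′
  ...   | no  _ = ≡.refl , mod-*-cong U≈U′ (mod-+-cong x≈x′ mod-refl)

  mod-1 : ∀ x y → x ≈ y [mod 1# ]
  mod-1 x y = congruent (x - y , *-identityʳ _)

  multiple≈0 : ∀ m → m * g ≈ 0# [mod g ]
  multiple≈0 m = ∣⇒≈0 (m , refl)

  weighted-sum-cong : ∀ {n} (a u v : Vector Carrier n) → (∀ k → u k ≈ v k [mod g ]) →
    MonoidSum.sum +-monoid (λ k → a k * u k) ≈ MonoidSum.sum +-monoid (λ k → a k * v k) [mod g ]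
  weighted-sum-cong {g} {n} a u v u≈v = sum-cong-≋ {n} λ k → mod-*-cong (mod-refl {a k}) (u≈v k)
    where open MonoidSum (CommutativeRing.+-monoid (R / g)) using (sum-cong-≋)

  mod-scale : ∀ z → x ≈ y [mod g ] → z * x ≈ z * y [mod z * g ]
  mod-scale {x} {y} {g} z x≈y with mod⇒≈+* x≈y
  ... | m , eq = ≈+*⇒mod m (begin
    z * x             ≈⟨ *-congˡ eq ⟩
    z * (y + m * g)   ≈⟨ solve 4 (λ z y m g → z :* (y :+ m :* g) := z :* y :+ m :* (z :* g)) refl z y m g ⟩
    z * y + m * (z * g) ∎)

  instance
    N≢0 : ℕ.NonZero N
    N≢0 = ℕ.>-nonZero (ℕ.≤-trans (s≤s z≤n) 2≤N)

  digits-cancel-≤ : ∀ i j {a a′} → toℕ {N} i ℕ.+ a ℕ.* N ℕ.≤ toℕ {N} j ℕ.+ a′ ℕ.* N → a ≤ a′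
  digits-cancel-≤ i j {a} {a′} le = ℕ.≤-pred (ℕ.*-cancelʳ-< N a (suc a′)
    (ℕ.≤-<-trans (ℕ.m≤n+m (a ℕ.* N) (toℕ i))
      (ℕ.≤-<-trans le (ℕ.+-monoˡ-< (a′ ℕ.* N) (Fin.toℕ<n j)))))

  -- The values at x and x′ of ∏ⱼ (X - bⱼ) / ∏ⱼ (bₖ - bⱼ) are z / w and z′ / w
  -- with w prime to P.
  record CongruentQuotients (g : Carrier) (k : ℕ) (x x′ : Carrier) : Set (c ⊔ ℓ) where
    field
      {w z z′} : Carrier
      P∤w      : ¬ P ∣ w
      eq       : falling k x * w ≈ z * falling k (extend k)
      eq′      : falling k x′ * w ≈ z′ * falling k (extend k)
      z≈z′     : z ≈ z′ [mod g ]

  quotients-zero : CongruentQuotients g 0 x x′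
  quotients-zero = record { P∤w = p∤1 ; eq = refl ; eq′ = refl ; z≈z′ = mod-refl }

  -- Congruence modulo 1 is void; the content is the common denominator, the product of the two that
  -- integrality supplies.
  quotients-unit : ∀ k → CongruentQuotients 1# k x x′
  quotients-unit {x} {x′} k =
    let z , w , eq , P∤w = Integral.integral (integral k) x
        z′ , w′ , eq′ , P∤w′ = Integral.integral (integral k) x′
        D = falling k (extend k)
    in record
    { w = w * w′ ; z = z * w′ ; z′ = z′ * w
    ; P∤w = ∤-* P∤w P∤w′
    ; eq = begin
        falling k x * (w * w′)   ≈⟨ *-assoc _ _ _ ⟨
        falling k x * w * w′     ≈⟨ *-congʳ eq ⟩
        z * D * w′               ≈⟨ solve 3 (λ z D w → z :* D :* w := z :* w :* D) refl z D w′ ⟩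
        z * w′ * D               ∎
    ; eq′ = begin
        falling k x′ * (w * w′)  ≈⟨ solve 3 (λ n w w′ → n :* (w :* w′) := n :* w′ :* w) refl (falling k x′) w w′ ⟩
        falling k x′ * w′ * w    ≈⟨ *-congʳ eq′ ⟩
        z′ * D * w               ≈⟨ solve 3 (λ z D w → z :* D :* w := z :* w :* D) refl z′ D w ⟩
        z′ * w * D               ∎
    ; z≈z′ = mod-1 _ _
    }

  -- The `P ^ a` of the denominator cancels against the `P ^ S.a` of the numerator, leaving
  -- `U * (P ^ m * ρ y)` in front of the quotient for `a`. This front factor is congruent modulo all
  -- of `P * g`, so `h` is limited only by `P * g` and by the quotient for `a`.
  quotients-digit : ∀ {g h} i j a → x ≈ b j + P * y → x′ ≈ b j + P * y′ →
    y ≈ y′ [mod g ] → h ∣ P * g → CongruentQuotients h a y y′ →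
    CongruentQuotients h (toℕ i ℕ.+ a ℕ.* N) x x′
  quotients-digit {x} {y} {x′} {y′} {g} {h} i j a x≈ x′≈ y≈y′ h∣Pg quotients = record
    { w    = V.U * w
    ; z    = S.U * (P ^ m * ρ y) * z
    ; z′   = S′.U * (P ^ m * ρ y′) * z′
    ; P∤w  = ∤-* V.P∤U P∤w
    ; eq   = cancel S.eq eq
    ; eq′  = cancel (subst (λ a → falling k x′ ≈ S′.U * (P ^ a * falling a y′)) (≡.sym a≡) S′.eq) eq′
    ; z≈z′ = mod-*-cong (mod-*-cong (mod-∣ h∣Pg U≈) (mod-∣ h∣Pg (power-cong m))) z≈z′
    }
    where
    open CongruentQuotients quotients
    k = toℕ i ℕ.+ a ℕ.* N
    D = falling a (extend a)
    module V = Split (splitting i (extend k) (extend a) (extend-step i a) k)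
    module S = Split (splitting j x y x≈ k)
    module S′ = Split (splitting j x′ y′ x′≈ k)

    x≈x′ : x ≈ x′ [mod P * g ]
    x≈x′ = mod-trans (≈⇒mod x≈) (mod-trans (mod-+-cong mod-refl (mod-scale P y≈y′)) (≈⇒mod (sym x′≈)))
    a≡ : S.a ≡ S′.a
    a≡ = proj₁ (splitting-cong j x≈ x′≈ k x≈x′)
    U≈ : S.U ≈ S′.U [mod P * g ]
    U≈ = proj₂ (splitting-cong j x≈ x′≈ k x≈x′)

    m = S.a ℕ.∸ a
    a≡+m : S.a ≡ a ℕ.+ m
    a≡+m = ≡.sym (ℕ.m+[n∸m]≡n (digits-cancel-≤ i j {a} {S.a} S.lower))
    ρ : Carrier → Carrier
    ρ t = proj₁ (falling-+ a m t)

    -- For `m = 0` the cofactor is 1; otherwise one `P` lifts its congruence from `g` to `P * g`.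
    power-cong : ∀ m → P ^ m * proj₁ (falling-+ a m y) ≈ P ^ m * proj₁ (falling-+ a m y′) [mod P * g ]
    power-cong zero    = mod-refl
    power-cong (suc m) = mod-trans (≈⇒mod (*-assoc _ _ _))
      (mod-trans (mod-scale P (mod-*-cong mod-refl (falling-+-cong a (suc m) y≈y′)))
        (≈⇒mod (sym (*-assoc _ _ _))))

    -- `k` itself has last digit `i`, so the indices below `k` that supply a `P` are exactly
    -- `i + lN` with `l < a`.
    V≡a : V.a ≡ a
    V≡a = ℕ.≤-antisym
      (ℕ.≤-pred (ℕ.*-cancelʳ-< N V.a (suc a) (ℕ.+-cancelˡ-< (toℕ i) _ _
        (subst (toℕ i ℕ.+ V.a ℕ.* N ℕ.<_)
          (≡.trans (ℕ.+-assoc (toℕ i) _ N) (≡.cong (toℕ i ℕ.+_) (ℕ.+-comm (a ℕ.* N) N))) V.upper))))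
      (digits-cancel-≤ i i {a} {V.a} V.lower)
    den-eq : falling k (extend k) ≈ V.U * (P ^ a * D)
    den-eq = subst (λ m → falling k (extend k) ≈ V.U * (P ^ m * falling m (extend a))) V≡a V.eq

    cancel : ∀ {s t U z} → falling k s ≈ U * (P ^ S.a * falling S.a t) → falling a t * w ≈ z * D →
      falling k s * (V.U * w) ≈ U * (P ^ m * ρ t) * z * falling k (extend k)
    cancel {s} {t} {U} {z} split-s quotient-t = begin
      falling k s * (V.U * w)                             ≈⟨ *-congʳ split-s ⟩
      U * (P ^ S.a * falling S.a t) * (V.U * w)
        ≈⟨ *-congʳ (*-congˡ (*-cong (trans (^-congʳ P a≡+m) (^-homo-* P a m))
             (trans (reflexive (≡.cong (λ n → falling n t) a≡+m)) (proj₂ (falling-+ a m t))))) ⟩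
      U * ((P ^ a * P ^ m) * (falling a t * ρ t)) * (V.U * w)
        ≈⟨ solve 7 (λ U Pᵃ Pᵐ n r V w → U :* ((Pᵃ :* Pᵐ) :* (n :* r)) :* (V :* w) :=
               U :* (Pᵐ :* r) :* (V :* Pᵃ) :* (n :* w))
             refl U (P ^ a) (P ^ m) (falling a t) (ρ t) V.U w ⟩
      U * (P ^ m * ρ t) * (V.U * P ^ a) * (falling a t * w) ≈⟨ *-congˡ quotient-t ⟩
      U * (P ^ m * ρ t) * (V.U * P ^ a) * (z * D)
        ≈⟨ solve 5 (λ T V Pᵃ z D → T :* (V :* Pᵃ) :* (z :* D) := T :* z :* (V :* (Pᵃ :* D)))
             refl (U * (P ^ m * ρ t)) V.U (P ^ a) z D ⟩
      U * (P ^ m * ρ t) * z * (V.U * (P ^ a * D))         ≈⟨ *-congˡ den-eq ⟨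
      U * (P ^ m * ρ t) * z * falling k (extend k)        ∎

  -- `x` and `x′` share the digit `j`. Only `x′` is divided; `y` is defined as `y′ + m * g`, which
  -- makes the tails congruent by construction.
  congruent-tails : x ≈ x′ [mod P * g ] → ∃ λ j → ∃ λ y → ∃ λ y′ →
    (x ≈ b j + P * y) × (x′ ≈ b j + P * y′) × (y ≈ y′ [mod g ])
  congruent-tails {x} {x′} {g} x≈x′ with b-complete x′ | mod⇒≈+* x≈x′
  ... | j , x′≈bj | m , x≈x′+mPg with mod⇒≈+* x′≈bj
  ...   | y′ , x′≈bj+y′P = j , y′ + m * g , y′ , (begin
    x                             ≈⟨ x≈x′+mPg ⟩
    x′ + m * (P * g)              ≈⟨ +-congʳ x′≈bj+y′P ⟩
    b j + y′ * P + m * (P * g)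
      ≈⟨ solve 5 (λ b y P m g → b :+ y :* P :+ m :* (P :* g) := b :+ P :* (y :+ m :* g)) refl (b j) y′ P m g ⟩
    b j + P * (y′ + m * g)        ∎) , trans x′≈bj+y′P (+-congˡ (*-comm y′ P)) , ≈+*⇒mod m refl

  -- Dividing by `P` lowers the exponent `s + r` by one. The decrease is charged to `s`, since `a`
  -- has one digit less than `k`, and `r` is kept. At `s = 0` the bound forces `a = 0`, where the
  -- quotient is 1 at every point.
  quotients-cong : ∀ s r k → k ℕ.< N ℕ.^ suc s → x ≈ x′ [mod P ^ (s ℕ.+ r) ] →
    CongruentQuotients (P ^ r) k x x′
  quotients-cong s zero    k k< x≈x′ = quotients-unit k
  quotients-cong {x} {x′} s (suc r) k k< x≈x′ with k divMod N
  ... | result a i k≡ with congruent-tails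
          (subst (λ t → x ≈ x′ [mod P ^ t ]) (ℕ.+-suc s r) x≈x′)
  ...   | j , y , y′ , x≈ , x′≈ , y≈y′ = subst (λ k → CongruentQuotients (P ^ suc r) k x x′) (≡.sym k≡)
    (quotients-digit i j a x≈ x′≈ y≈y′ (P^-∣ {suc r} {suc (s ℕ.+ r)} (s≤s (ℕ.m≤n+m r s)))
      (tails s y≈y′ (ℕ.*-cancelʳ-< N a (N ℕ.^ s) (ℕ.≤-<-trans (ℕ.m≤n+m (a ℕ.* N) (toℕ i))
        (subst (toℕ i ℕ.+ a ℕ.* N ℕ.<_) (ℕ.*-comm N (N ℕ.^ s)) (subst (ℕ._< N ℕ.^ suc s) k≡ k<))))))
    where
    tails : ∀ s → y ≈ y′ [mod P ^ (s ℕ.+ r) ] → a ℕ.< N ℕ.^ s → CongruentQuotients (P ^ suc r) a y y′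
    tails zero    y≈y′ (s≤s z≤n) = quotients-zero
    tails (suc s) y≈y′ a<  = quotients-cong s (suc r) a a<
      (subst (λ t → y ≈ y′ [mod P ^ t ]) (≡.sym (ℕ.+-suc s r)) y≈y′)

  -- `k′` consists of the lowest `m` digits of `k`. The digits above contribute a multiple of
  -- `P ^ m`, and they are not all zero because `N ^ m ≤ k`, whence `k′ < k`.
  extend-drop : ∀ m k → N ℕ.^ m ≤ k → ∃ λ k′ → k′ ℕ.< k × (extend k ≈ extend k′ [mod P ^ m ])
  extend-drop zero    k 1≤k = 0 , 1≤k , mod-1 _ _
  extend-drop (suc m) k ≤k with k divMod N
  ... | result a i k≡ with extend-drop m a (ℕ.≮⇒≥ λ a< → ℕ.<-irrefl ≡.refl
          (ℕ.<-≤-trans (ℕ.≤-<-trans (ℕ.≤-reflexive k≡) (digit-bound a i a<)) ≤k))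
    where
    digit-bound : ∀ a (i : Fin N) → a ℕ.< N ℕ.^ m → toℕ i ℕ.+ a ℕ.* N ℕ.< N ℕ.* N ℕ.^ m
    digit-bound a i a< = ℕ.<-≤-trans (ℕ.+-monoˡ-< (a ℕ.* N) (Fin.toℕ<n i))
      (ℕ.≤-trans (ℕ.*-monoˡ-≤ N a<) (ℕ.≤-reflexive (ℕ.*-comm (N ℕ.^ m) N)))
  ...   | a′ , a′<a , eq = toℕ i ℕ.+ a′ ℕ.* N ,
    subst (toℕ i ℕ.+ a′ ℕ.* N ℕ.<_) (≡.sym k≡) (ℕ.+-monoʳ-< (toℕ i) (ℕ.*-monoˡ-< N a′<a)) ,
    mod-trans (≈⇒mod (trans (reflexive (≡.cong extend k≡)) (extend-step i a)))
      (mod-trans (mod-+-cong mod-refl (mod-scale P eq)) (≈⇒mod (sym (extend-step i a′))))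

  -- Values at the nodes `extend j`.

  extend-zero : extend 0 ≈ 0#
  extend-zero = evaluate-zero (proj₁ digits) (proj₂ digits)
    where digits = toDigits N {Dec.fromWitness 2≤N} 0

  falling-root : ∀ {j k} → j ℕ.< k → x ≈ extend j → falling k x ≈ 0#
  falling-root {x} {j} {k} j<k x≈ with falling-+ (suc j) (k ℕ.∸ suc j) x
  ... | r , eq = begin
    falling k x                           ≈⟨ reflexive (≡.cong (λ n → falling n x) (ℕ.m+[n∸m]≡n j<k)) ⟨
    falling (suc j ℕ.+ (k ℕ.∸ suc j)) x   ≈⟨ eq ⟩
    falling (suc j) x * r                 ≈⟨ *-congʳ (falling-suc j x) ⟩
    falling j x * (x - extend j) * r      ≈⟨ *-congʳ (*-congˡ (trans (+-congʳ x≈) (-‿inverseʳ _))) ⟩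
    falling j x * 0# * r                  ≈⟨ *-congʳ (zeroʳ _) ⟩
    0# * r                                ≈⟨ zeroˡ r ⟩
    0#                                    ∎

  -- A repeated node would be a root of the denominator of `Q` at the larger index, which is known
  -- not to vanish.
  extend-injective : ∀ {j k} → extend j ≈ extend k → j ≡ k
  extend-injective {j} {k} eq with ℕ.<-cmp j k
  ... | tri≈ _ j≡k _ = j≡k
  ... | tri< j<k _ _ = contradiction (falling-root j<k (sym eq)) (Integral.den≉0 (integral k))
  ... | tri> _ _ k<j = contradiction (falling-root k<j eq) (Integral.den≉0 (integral j))

  -- Residues of the quotients modulo `P ^ e`.

  module _ (e : ℕ) where
    Qᵉ : ℕ → Carrier → Carrier
    Qᵉ k x = reduce e (Q k x) (Q-integral k x)

    Qᵉ-resp-≈ : ∀ k → x ≈ x′ → Qᵉ k x ≈ Qᵉ k x′ [mod P ^ e ]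
    Qᵉ-resp-≈ {x} {x′} k x≈x′ =
      reduce-cong e (Q k x) (Q k x′) (Q-integral k x) (Q-integral k x′) (Q-cong k x≈x′)

    Qᵉ-diagonal : ∀ k → Qᵉ k (extend k) ≈ 1# [mod P ^ e ]
    Qᵉ-diagonal k = reduce-unique e (Q k (extend k)) (Q-integral k (extend k)) p∤1
      (*-comm _ _) 1# (≈⇒mod (*-identityˡ 1#))

    Qᵉ-root : ∀ {j k} → j ℕ.< k → Qᵉ k (extend j) ≈ 0# [mod P ^ e ]
    Qᵉ-root {j} {k} j<k = reduce-unique e (Q k (extend j)) (Q-integral k (extend j)) p∤1
      (trans (*-congʳ (falling-root j<k refl)) (trans (zeroˡ _) (sym (zeroˡ _)))) 0# (≈⇒mod (zeroʳ 1#))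

    -- `reduce` uses a separate denominator at each point. Multiplying both residues by the common
    -- `w` gives congruent numerators, and `w` is then cancelled through its inverse modulo `P ^ e`,
    -- which remains an inverse modulo `P ^ r`.
    Qᵉ-cong : ∀ s r k → r ≤ e → k ℕ.< N ℕ.^ suc s → x ≈ x′ [mod P ^ (s ℕ.+ r) ] →
      Qᵉ k x ≈ Qᵉ k x′ [mod P ^ r ]
    Qᵉ-cong {x} {x′} s r k r≤e k< x≈x′ = mod-trans (mod-sym (cancel (Qᵉ k x)))
      (mod-trans (mod-*-cong mod-refl
        (mod-trans (mod-∣ Pʳ∣Pᵉ (reduce-spec e (Q k x) (Q-integral k x) eq)) (mod-trans z≈z′
          (mod-∣ Pʳ∣Pᵉ (mod-sym (reduce-spec e (Q k x′) (Q-integral k x′) eq′))))))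
        (cancel (Qᵉ k x′)))
      where
      open CongruentQuotients (quotients-cong s r k k< x≈x′)
      Pʳ∣Pᵉ = P^-∣ r≤e
      u = proj₁ (inverseMod e w P∤w)
      cancel : ∀ t → u * (w * t) ≈ t [mod P ^ r ]
      cancel t = mod-trans (≈⇒mod (sym (*-assoc u w t)))
        (mod-trans (mod-*-cong (mod-∣ Pʳ∣Pᵉ (proj₂ (inverseMod e w P∤w))) mod-refl) (≈⇒mod (*-identityˡ t)))

    -- The powers of P that Qᵉ k may lose are made up for by the coefficient.
    scaled-Qᵉ-cong : ∀ s k i {t} → i ≤ e → k ℕ.< N ℕ.^ suc s → t ≈ 0# [mod P ^ (s ℕ.⊓ e) ] →
      x ≈ x′ [mod P ^ i ] → t * Qᵉ k x ≈ t * Qᵉ k x′ [mod P ^ i ]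
    scaled-Qᵉ-cong {x} {x′} s k i {t} i≤e k< t≈0 x≈x′ with ℕ.≤-total i s
    ... | inj₁ i≤s = mod-trans (vanish (Qᵉ k x)) (mod-sym (vanish (Qᵉ k x′)))
      where
      vanish : ∀ v → t * v ≈ 0# [mod P ^ i ]
      vanish v = mod-trans (mod-*-cong (mod-∣ (P^-∣ (ℕ.⊓-glb i≤s i≤e)) t≈0) mod-refl) (≈⇒mod (zeroˡ v))
    ... | inj₂ s≤i with ≈0⇒∣ (subst (λ j → t ≈ 0# [mod P ^ j ]) (ℕ.m≤n⇒m⊓n≡m (ℕ.≤-trans s≤i i≤e)) t≈0)
    ...   | m , mPˢ≈t = mod-trans (factor (Qᵉ k x)) (mod-trans
      (mod-*-cong mod-refl (mod-∣ Pⁱ∣PˢPʳ (mod-scale (P ^ s)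
        (Qᵉ-cong s r k (ℕ.≤-trans (ℕ.m∸n≤m i s) i≤e) k< (subst (λ j → x ≈ x′ [mod P ^ j ]) (≡.sym s+r≡i) x≈x′)))))
      (mod-sym (factor (Qᵉ k x′))))
      where
      r = i ℕ.∸ s
      s+r≡i : s ℕ.+ r ≡ i
      s+r≡i = ℕ.m+[n∸m]≡n s≤i
      Pⁱ∣PˢPʳ : P ^ i ∣ P ^ s * P ^ r
      Pⁱ∣PˢPʳ = 1# , trans (*-identityˡ _) (trans (^-congʳ P (≡.sym s+r≡i)) (^-homo-* P s r))
      factor : ∀ v → t * v ≈ m * (P ^ s * v) [mod P ^ i ]
      factor v = ≈⇒mod (trans (*-congʳ (sym mPˢ≈t)) (*-assoc _ _ _))

  -- As `P` is prime, one `P` in `m * h ≈ P * P ^ e` can be cancelled against `m` or against `h`,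
  -- and only the second case raises `i`. Mutual divisibility stands in for equality up to a unit.
  divisor-of-P^ : ∀ e {h} → h ∣ P ^ e → ∃ λ i → i ≤ e × h ∣ P ^ i × P ^ i ∣ h
  divisor-of-P^ zero    {h} h∣1 = 0 , z≤n , h∣1 , (h , *-identityʳ h)
  divisor-of-P^ (suc e) {h} (m , mh≈PPᵉ) with split-∣ {m} {h} (P ^ e , trans (*-comm _ _) (sym mh≈PPᵉ))
  ... | inj₁ (m′ , m′P≈m) =
    let i , i≤e , h∣Pⁱ , Pⁱ∣h = divisor-of-P^ e (m′ , *-cancelʳ p≉0 (begin
          m′ * h * P     ≈⟨ solve 3 (λ m h P → m :* h :* P := m :* P :* h) refl m′ h P ⟩
          m′ * P * h     ≈⟨ *-congʳ m′P≈m ⟩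
          m * h          ≈⟨ mh≈PPᵉ ⟩
          P * P ^ e      ≈⟨ *-comm _ _ ⟩
          P ^ e * P      ∎))
    in i , ℕ.m≤n⇒m≤1+n i≤e , h∣Pⁱ , Pⁱ∣h
  ... | inj₂ (h′ , h′P≈h) =
    let i , i≤e , (s , sh′≈Pⁱ) , (t , tPⁱ≈h′) = divisor-of-P^ e (m , *-cancelʳ p≉0 (begin
          m * h′ * P     ≈⟨ *-assoc m h′ P ⟩
          m * (h′ * P)   ≈⟨ *-congˡ h′P≈h ⟩
          m * h          ≈⟨ mh≈PPᵉ ⟩
          P * P ^ e      ≈⟨ *-comm _ _ ⟩
          P ^ e * P      ∎))
    in suc i , s≤s i≤e
     , (s , (begin
          s * h          ≈⟨ *-congˡ h′P≈h ⟨
          s * (h′ * P)   ≈⟨ solve 3 (λ s h P → s :* (h :* P) := P :* (s :* h)) refl s h′ P ⟩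
          P * (s * h′)   ≈⟨ *-congˡ sh′≈Pⁱ ⟩
          P * P ^ i      ∎))
     , (t , (begin
          t * (P * P ^ i)  ≈⟨ solve 3 (λ t P Pⁱ → t :* (P :* Pⁱ) := t :* Pⁱ :* P) refl t P (P ^ i) ⟩
          t * P ^ i * P    ≈⟨ *-congʳ tPⁱ≈h′ ⟩
          h′ * P           ≈⟨ h′P≈h ⟩
          h                ∎))

  module _ (e : ℕ) where
    private
      module 𝔸ₑ = CommutativeRing (R / (P ^ e))

    open SemiringDivisibility 𝔸ₑ.semiring using () renaming (_∣_ to _∣ᵉ_; _,_ to _,ᵉ_)

    -- In the residue ring `P ^ s` is zero once `s ≥ e`, so its multiples are the classes vanishing
    -- modulo `P ^ (s ⊓ e)`. In this form the condition can be used modulo smaller powers of `P`.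
    P^-∣ᵉ⇒ : ∀ s t → (P ^ s) ∣ᵉ t → t ≈ 0# [mod P ^ (s ℕ.⊓ e) ]
    P^-∣ᵉ⇒ s t (m ,ᵉ mPˢ≈t) = mod-trans (mod-∣ (P^-∣ (ℕ.m⊓n≤n s e)) (mod-sym mPˢ≈t))
      (mod-∣ (P^-∣ (ℕ.m⊓n≤m s e)) (multiple≈0 m))

    ⇒P^-∣ᵉ : ∀ s t → t ≈ 0# [mod P ^ (s ℕ.⊓ e) ] → (P ^ s) ∣ᵉ t
    ⇒P^-∣ᵉ s t t≈0 with ℕ.≤-total s e
    ... | inj₁ s≤e =
      let m , t≈0+mPˢ = mod⇒≈+* (subst (λ j → t ≈ 0# [mod P ^ j ]) (ℕ.m≤n⇒m⊓n≡m s≤e) t≈0)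
      in m ,ᵉ ≈⇒mod (sym (trans t≈0+mPˢ (+-identityˡ _)))
    ... | inj₂ e≤s = 0# ,ᵉ mod-trans (≈⇒mod (zeroˡ _))
      (mod-sym (subst (λ j → t ≈ 0# [mod P ^ j ]) (ℕ.m≥n⇒m⊓n≡n e≤s) t≈0))

  -- Expansions in the `Qᵉ k` and divisibility of their coefficients.

  module Expansions (e : ℕ) (μ : ℕ → ℕ) (μ-zero : μ 0 ≡ 0)
    (μ-lower : ∀ k → 1 ≤ k → N ℕ.^ μ k ≤ k) (μ-upper : ∀ k → k ℕ.< N ℕ.^ suc (μ k))
    where

    open MonoidSum +-monoid using (sum)

    combination : ∀ {M} → Vector Carrier M → Carrier → Carrier
    combination a x = sum λ k → a k * Qᵉ e (toℕ k) x

    combination-cong : ∀ {M} (a : Vector Carrier M) → (∀ k → a k ≈ 0# [mod P ^ (μ (toℕ k) ℕ.⊓ e) ]) →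
      ∀ i → i ≤ e → x ≈ x′ [mod P ^ i ] → combination a x ≈ combination a x′ [mod P ^ i ]
    combination-cong {x} {x′} {M} a a≈0 i i≤e x≈x′ = sum-cong-≋ {M} λ k →
      scaled-Qᵉ-cong e (μ (toℕ k)) (toℕ k) i i≤e (μ-upper (toℕ k)) (a≈0 k) x≈x′
      where open MonoidSum (CommutativeRing.+-monoid (R / (P ^ i))) using (sum-cong-≋)

    interpolation-∃! : ∀ M (v : ℕ → Carrier) →
      ∃! (λ a a′ → ∀ k → a k ≈ a′ k [mod P ^ e ]) λ (a : Vector Carrier M) →
        ∀ (j : Fin M) → v (toℕ j) ≈ combination a (extend (toℕ j)) [mod P ^ e ]
    interpolation-∃! M = unitriangular-∃! (R / (P ^ e)) M (λ k j → Qᵉ e k (extend j))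
      (Qᵉ-diagonal e) (Qᵉ-root e)

    -- At `bₖ` and `bₖ′` the terms above `k` vanish, and those below agree modulo `P ^ i` because
    -- their coefficients are already known to be divisible. The `k`-th term is `a k` at `bₖ` and 0
    -- at `bₖ′`, so congruent values of `v` force `a k` to vanish.
    coefficients-divisible : ∀ {M} (v : ℕ → Carrier) (a : Vector Carrier M) →
      (∀ (j : Fin M) → v (toℕ j) ≈ combination a (extend (toℕ j)) [mod P ^ e ]) →
      (∀ j k i → j ℕ.< M → k ℕ.< M → i ≤ e →
        extend j ≈ extend k [mod P ^ i ] → v j ≈ v k [mod P ^ i ]) →
      ∀ k → a k ≈ 0# [mod P ^ (μ (toℕ k) ℕ.⊓ e) ]
    coefficients-divisible {M} v a expands preserving k = go k (<-wellFounded k)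
      where
      go : ∀ (k : Fin M) → Acc Fin._<_ k → a k ≈ 0# [mod P ^ (μ (toℕ k) ℕ.⊓ e) ]
      go k (acc smaller) with toℕ k ℕ.≟ 0
      -- There is no smaller index to compare with, but `μ 0 ≡ 0` makes the claim a congruence
      -- modulo 1.
      ... | yes k≡0 = subst (λ s → a k ≈ 0# [mod P ^ (s ℕ.⊓ e) ])
        (≡.sym (≡.trans (≡.cong μ k≡0) μ-zero)) (mod-1 _ _)
      ... | no  k≢0 with extend-drop (μ (toℕ k)) (toℕ k) (μ-lower (toℕ k) (ℕ.n≢0⇒n>0 k≢0))
      ...   | k′ , k′<k , dropped = mod-trans (mod-sym at-k) (mod-trans
        (sum-isolate (CommutativeRing.+-group (R / (P ^ i))) k others sums) at-k′)
        where
        i = μ (toℕ k) ℕ.⊓ e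
        i≤e : i ≤ e
        i≤e = ℕ.m⊓n≤n (μ (toℕ k)) e
        Pⁱ∣Pᵉ : P ^ i ∣ P ^ e
        Pⁱ∣Pᵉ = P^-∣ i≤e
        bₖ = extend (toℕ k)
        bₖ′ = extend k′
        bₖ≈bₖ′ : bₖ ≈ bₖ′ [mod P ^ i ]
        bₖ≈bₖ′ = mod-∣ (P^-∣ (ℕ.m⊓n≤m (μ (toℕ k)) e)) dropped
        k′<M : k′ ℕ.< M
        k′<M = ℕ.<-trans k′<k (Fin.toℕ<n k)
        expands′ : v k′ ≈ combination a bₖ′ [mod P ^ e ]
        expands′ = subst (λ j → v j ≈ combination a (extend j) [mod P ^ e ])
          (Fin.toℕ-fromℕ< k′<M) (expands (fromℕ< k′<M))
        sums : combination a bₖ ≈ combination a bₖ′ [mod P ^ i ]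
        sums = mod-trans (mod-∣ Pⁱ∣Pᵉ (mod-sym (expands k)))
          (mod-trans (preserving (toℕ k) k′ i (Fin.toℕ<n k) k′<M i≤e bₖ≈bₖ′) (mod-∣ Pⁱ∣Pᵉ expands′))
        *-root : ∀ {t} j → t ℕ.< j → ∀ s → s * Qᵉ e j (extend t) ≈ 0# [mod P ^ i ]
        *-root j t<j s = mod-trans (mod-*-cong mod-refl (mod-∣ Pⁱ∣Pᵉ (Qᵉ-root e t<j))) (≈⇒mod (zeroʳ s))
        others : ∀ j → j ≢ k → a j * Qᵉ e (toℕ j) bₖ ≈ a j * Qᵉ e (toℕ j) bₖ′ [mod P ^ i ]
        others j j≢k with ℕ.<-cmp (toℕ j) (toℕ k)
        ... | tri< j<k _ _ = scaled-Qᵉ-cong e (μ (toℕ j)) (toℕ j) i i≤e (μ-upper (toℕ j))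
          (go j (smaller j<k)) bₖ≈bₖ′
        ... | tri≈ _ j≡k _ = contradiction (Fin.toℕ-injective j≡k) j≢k
        ... | tri> _ _ k<j = mod-trans (*-root (toℕ j) k<j (a j))
          (mod-sym (*-root (toℕ j) (ℕ.<-trans k′<k k<j) (a j)))
        at-k : a k * Qᵉ e (toℕ k) bₖ ≈ a k [mod P ^ i ]
        at-k = mod-trans (mod-*-cong mod-refl (mod-∣ Pⁱ∣Pᵉ (Qᵉ-diagonal e (toℕ k)))) (≈⇒mod (*-identityʳ _))
        at-k′ : a k * Qᵉ e (toℕ k) bₖ′ ≈ 0# [mod P ^ i ]
        at-k′ = *-root (toℕ k) k′<k (a k)

-- The first q^n nodes are the polynomials of degree less than n.

module Interpolation (q : ℕ) (F : HeytingField c ℓ₁ ℓ₂)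
  (enumeration : Inverse (CommutativeRing.setoid (fieldRing F)) (≡.setoid (Fin q)))
  where

  open FiniteField F q enumeration
  open CommutativeRing 𝔸 hiding (zero)
  open Congruence 𝔸

  private
    module F = CommutativeRing (fieldRing F)
    module Elements = Inverse enumeration

    instance
      q≢0 : ℕ.NonZero q
      q≢0 = ℕ.>-nonZero (ℕ.≤-trans (s≤s z≤n) 2≤q)

  deg-∷ : ∀ {a h n} → deg h < n → deg (a ∷ h) < suc n
  deg-∷ deg-h (suc i) (s≤s n≤i) = deg-h i n≤i

  uncons : ∀ {n} h → deg h < suc n → ∃ λ a → ∃ λ t → (a ∷ t ≈ h) × (deg t < n)
  uncons {n} []      _      = F.0# , [] , 0∷[]≈[] , deg-[] n
  uncons     (a ∷ t) deg-∷t = a , t , refl , λ i n≤i → deg-∷t (suc i) (s≤s n≤i)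

  deg-+ : ∀ {g h n} → deg g < n → deg h < n → deg (g + h) < n
  deg-+ {g} {h} deg-g deg-h i n≤i = F.trans (coeff-+ g h i)
    (F.trans (F.+-cong (deg-g i n≤i) (deg-h i n≤i)) (F.+-identityˡ _))

  deg-* : ∀ {g h m n} → deg g < suc m → deg h < n → deg (g * h) < (m ℕ.+ n)
  deg-* {g} {h} {m} {n} deg-g deg-h i m+n≤i = subst (λ i → coeff (g * h) i F.≈ F.0#) (ℕ.m+[n∸m]≡n m≤i)
    (F.trans (coeff-*-top g h m (i ℕ.∸ m) deg-g (deg-weaken {h} (ℕ.m≤n⇒m≤1+n n≤i∸m) deg-h))
      (F.trans (F.*-congˡ (deg-h (i ℕ.∸ m) n≤i∸m)) (F.zeroʳ _)))
    where
    m≤i : m ≤ i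
    m≤i = ℕ.≤-trans (ℕ.m≤m+n m n) m+n≤i
    n≤i∸m : n ≤ i ℕ.∸ m
    n≤i∸m = ℕ.≤-trans (ℕ.≤-reflexive (≡.sym (ℕ.m+n∸m≡n m n))) (ℕ.∸-monoˡ-≤ m m+n≤i)

  deg<0# : ∀ {h n} → h ≈ 0# → deg h < n
  deg<0# h≈0 i _ = at h≈0 i

  -- A second list of the polynomials of degree less than `n`, independent of the given ordering and
  -- used for pigeonhole arguments.
  enumerate : ∀ n → Fin (q ℕ.^ n) → Carrier
  enumerate zero    _ = []
  enumerate (suc n) i = let a , j = remQuot {q} (q ℕ.^ n) i in Elements.from a ∷ enumerate n j

  enumerate-deg : ∀ n i → deg (enumerate n i) < n
  enumerate-deg zero    i = deg-[] 0
  enumerate-deg (suc n) i = deg-∷ {h = enumerate n _} (enumerate-deg n _)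

  enumerate-injective : ∀ n i j → enumerate n i ≈ enumerate n j → i ≡ j
  enumerate-injective zero    zero zero _ = ≡.refl
  enumerate-injective (suc n) i j eq = ≡.trans (≡.sym (Fin.combine-remQuot {q} (q ℕ.^ n) i))
    (≡.trans (≡.cong₂ combine head tail) (Fin.combine-remQuot {q} (q ℕ.^ n) j))
    where
    head : proj₁ (remQuot {q} (q ℕ.^ n) i) ≡ proj₁ (remQuot (q ℕ.^ n) j)
    head = ≡.trans (≡.sym (Elements.strictlyInverseˡ _))
      (≡.trans (Elements.to-cong (at eq 0)) (Elements.strictlyInverseˡ _))
    tail : proj₂ (remQuot {q} (q ℕ.^ n) i) ≡ proj₂ (remQuot {q} (q ℕ.^ n) j)
    tail = enumerate-injective n _ _ (coeffwise λ k → at eq (suc k))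

  enumerate-surjective : ∀ n h → deg h < n → ∃ λ i → enumerate n i ≈ h
  enumerate-surjective zero    h deg-h = zero , sym (deg<0⇒≈0 deg-h)
  enumerate-surjective (suc n) h deg-h with uncons h deg-h
  ... | a₀ , t , split , deg-t = combine a i ,
    trans decode (trans (∷-cong (Elements.strictlyInverseʳ a₀) (proj₂ tail)) split)
    where
    tail = enumerate-surjective n t deg-t
    a = Elements.to a₀
    i = proj₁ tail
    decode : enumerate (suc n) (combine a i) ≈ Elements.from a ∷ enumerate n i
    decode = reflexive (≡.cong (λ (a , i) → Elements.from a ∷ enumerate n i) (Fin.remQuot-combine a i))

  module _ {d : ℕ} (ordering : Ordering d) where
    open Ordering ordering

    -- If deg bᵢ ≥ m, then by monotonicity all polynomials of degree less
    -- than m come before bᵢ.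
    ordering-deg : ∀ m i → toℕ i ℕ.< q ℕ.^ m → deg (b i) < m
    ordering-deg m i i< with degree (b i)
    ... | inj₁ bᵢ≈0 = deg<0# bᵢ≈0
    ... | inj₂ (t , deg-bᵢ) with t ℕ.<? m
    ...   | yes t<m = deg-weaken {b i} t<m (proj₂ deg-bᵢ)
    -- The q^m polynomials of degree less than `m` would inject into the indices below `i`, which
    -- are fewer than q^m.
    ...   | no  t≮m = contradiction i< (ℕ.≤⇒≯ (Fin.injective⇒≤ {f = f} f-injective))
      where
      m≤t : m ≤ t
      m≤t = ℕ.≮⇒≥ t≮m
      t<d : t ℕ.< d
      t<d = ℕ.≰⇒> λ d≤t → proj₁ deg-bᵢ (b-deg i t d≤t)
      index : ∀ j → ∃ λ k → b k ≈ enumerate m j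
      index j = surjective (enumerate m j)
        (deg-weaken {enumerate m j} (ℕ.≤-trans m≤t (ℕ.<⇒≤ t<d)) (enumerate-deg m j))
      0<i : 0 ℕ.< toℕ i
      0<i = ℕ.n≢0⇒n>0 λ i≡0 → proj₁ deg-bᵢ (at (b₀≈0 i i≡0) t)
      before : ∀ j → toℕ (proj₁ (index j)) ℕ.< toℕ i
      before j with index j
      ... | k , bₖ≈ with degree (b k)
      -- `monotone` compares only nonzero polynomials; zero has index 0 by injectivity, and `b i` is
      -- nonzero.
      ...   | inj₁ bₖ≈0 = subst (ℕ._< toℕ i) (≡.sym (≡.trans (≡.cong toℕ k≡0) (Fin.toℕ-fromℕ< 0<N))) 0<i
        where
        0<N : 0 ℕ.< q ℕ.^ d
        0<N = ℕ.m^n>0 q d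
        k≡0 : k ≡ fromℕ< 0<N
        k≡0 = injective k (fromℕ< 0<N) (trans bₖ≈0 (sym (b₀≈0 _ (Fin.toℕ-fromℕ< 0<N))))
      ...   | inj₂ (s , deg-bₖ) = ℕ.≰⇒> λ i≤k → contradiction
        (F.trans (at bₖ≈ s) (enumerate-deg m j s (ℕ.≤-trans m≤t (monotone i k 0<i i≤k t s deg-bᵢ deg-bₖ))))
        (proj₁ deg-bₖ)
      f : Fin (q ℕ.^ m) → Fin (toℕ i)
      f j = fromℕ< (before j)
      f-injective : ∀ {j k} → f j ≡ f k → j ≡ k
      f-injective {j} {k} fj≡fk = enumerate-injective m j k
        (trans (sym (proj₂ (index j))) (trans (reflexive (≡.cong b same)) (proj₂ (index k))))
        where
        same : proj₁ (index j) ≡ proj₁ (index k)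
        same = Fin.toℕ-injective (≡.trans (≡.sym (Fin.toℕ-fromℕ< (before j)))
          (≡.trans (≡.cong toℕ fj≡fk) (Fin.toℕ-fromℕ< (before k))))

  module _ (P : Carrier) (d : ℕ) (deg-P : deg P ≡ d) (1≤d : 1 ≤ d)
    (irreducible : Irreducible P) (ordering : Ordering d)
    where

    open Wagner P d deg-P 1≤d irreducible ordering
    private
      module O = Ordering ordering

    2≤qᵈ : 2 ≤ q ℕ.^ d
    2≤qᵈ = ℕ.≤-trans 2≤q (ℕ.≤-trans (ℕ.≤-reflexive (≡.sym (ℕ.^-identityʳ q)))
      (ℕ.^-monoʳ-≤ q {{ℕ.>-nonZero (ℕ.≤-trans (s≤s z≤n) 2≤q)}} 1≤d))

    open NewtonCongruence 𝔸 P (q ℕ.^ d) 2≤qᵈ O.b *-noZeroDivisors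
      (Bezout.prime P d deg-P irreducible) (Bezout.bezout P d deg-P irreducible) completeResidues

    -- Removing the last digit divides `j` by q^d and lowers the degree bound by `d`. Once `n < d`
    -- only one digit is left, and there the ordering by degree gives the bound.
    b-deg : ∀ n j → j ℕ.< q ℕ.^ n → deg (b j) < n
    b-deg = <-rec (λ n → ∀ j → j ℕ.< q ℕ.^ n → deg (b j) < n) go
      where
      N = q ℕ.^ d
      go : ∀ n → (∀ {m} → m ℕ.< n → ∀ j → j ℕ.< q ℕ.^ m → deg (b j) < m) →
           ∀ j → j ℕ.< q ℕ.^ n → deg (b j) < n
      go n rec j j< with j divMod N
      ... | result a i j≡ = deg-cong (sym (trans (reflexive (≡.cong b j≡)) (extend-step i a)))
        (deg-+ {O.b i} {P * b a} (ordering-deg ordering n i (ℕ.≤-<-trans (ℕ.m≤m+n (toℕ i) (a ℕ.* N)) j<′))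
          tail)
        where
        j<′ : toℕ i ℕ.+ a ℕ.* N ℕ.< q ℕ.^ n
        j<′ = subst (ℕ._< q ℕ.^ n) j≡ j<
        aN< : a ℕ.* N ℕ.< q ℕ.^ n
        aN< = ℕ.≤-<-trans (ℕ.m≤n+m (a ℕ.* N) (toℕ i)) j<′
        tail : deg (P * b a) < n
        tail with d ℕ.≤? n
        ... | yes d≤n = subst (deg (P * b a) <_) (ℕ.m+[n∸m]≡n d≤n)
          (deg-* {P} {b a} (proj₂ deg-P) (rec (ℕ.∸-monoʳ-< {n} 1≤d d≤n) a
            (ℕ.*-cancelʳ-< N a (q ℕ.^ (n ℕ.∸ d)) (subst (a ℕ.* N ℕ.<_)
              (≡.trans (≡.cong (q ℕ.^_) (≡.sym (ℕ.m∸n+n≡m d≤n))) (ℕ.^-distribˡ-+-* q (n ℕ.∸ d) d)) aN<))))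
        ... | no  d≰n = deg<0# (trans (*-congˡ {P} (trans (reflexive (≡.cong b a≡0)) extend-zero)) (zeroʳ P))
          where
          a≡0 : a ≡ 0
          a≡0 = ℕ.n<1⇒n≡0 (ℕ.*-cancelʳ-< N a 1 (ℕ.<-≤-trans aN<
            (ℕ.≤-trans (ℕ.^-monoʳ-≤ q (ℕ.<⇒≤ (ℕ.≰⇒> d≰n))) (ℕ.≤-reflexive (≡.sym (ℕ.*-identityˡ N))))))

    -- Pigeonhole: a missed `h` together with the q^n distinct nodes would give q^n + 1 distinct
    -- polynomials of degree less than `n`.
    b-surjective : ∀ n h → deg h < n → ∃ λ (j : Fin (q ℕ.^ n)) → b (toℕ j) ≈ h
    b-surjective n h deg-h with Fin.any? (λ j → ≈? (b (toℕ j)) h)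
      where
      ≈? : ∀ g h → Dec (g ≈ h)
      ≈? g h = Dec.map′ (x∙y⁻¹≈ε⇒x≈y g h) x≈y⇒x∙y⁻¹≈ε (≈0? (g - h))
        where open AbelianGroupProperties +-abelianGroup using (x∙y⁻¹≈ε⇒x≈y; x≈y⇒x∙y⁻¹≈ε)
    ... | yes found = found
    ... | no  h≉b   = contradiction (Fin.injective⇒≤ {f = f} f-injective) ℕ.1+n≰n
      where
      h∷b : Fin (suc (q ℕ.^ n)) → Carrier
      h∷b zero    = h
      h∷b (suc j) = b (toℕ j)
      index : ∀ j → ∃ λ i → enumerate n i ≈ h∷b j
      index zero    = enumerate-surjective n h deg-h
      index (suc j) = enumerate-surjective n (b (toℕ j)) (b-deg n (toℕ j) (Fin.toℕ<n j))
      f : Fin (suc (q ℕ.^ n)) → Fin (q ℕ.^ n)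
      f j = proj₁ (index j)
      h∷b-injective : ∀ j k → h∷b j ≈ h∷b k → j ≡ k
      h∷b-injective zero    zero    _  = ≡.refl
      h∷b-injective zero    (suc k) eq = contradiction (k , sym eq) h≉b
      h∷b-injective (suc j) zero    eq = contradiction (j , eq) h≉b
      h∷b-injective (suc j) (suc k) eq = ≡.cong suc (Fin.toℕ-injective (extend-injective eq))
      f-injective : ∀ {j k} → f j ≡ f k → j ≡ k
      f-injective {j} {k} fj≡fk = h∷b-injective j k
        (trans (sym (proj₂ (index j))) (trans (reflexive (≡.cong (enumerate n) fj≡fk)) (proj₂ (index k))))

    <^-suc-μ : ∀ k → k ℕ.< (q ℕ.^ d) ℕ.^ suc (μ q d k)
    <^-suc-μ k = ℕ.≰⇒> λ le → ℕ.1+n≰n (μ-greatest q d k 2≤q 1≤d (suc (μ q d k))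
      (subst (ℕ._≤ k) (ℕ.^-*-assoc q d (suc (μ q d k))) le))

    ^-μ≤ : ∀ k → 1 ≤ k → (q ℕ.^ d) ℕ.^ μ q d k ≤ k
    ^-μ≤ k 1≤k = ℕ.≤-trans (ℕ.≤-reflexive (ℕ.^-*-assoc q d (μ q d k))) (μ-lower q d k 1≤k)

    -- Expansions of `σ` and the two implications.

    module _ (f : Carrier) (n : ℕ) (deg-f : deg f ≡ n) (e : ℕ)
      (σ : Func (CommutativeRing.setoid (𝔸 / f)) (CommutativeRing.setoid (𝔸 / (P ^ e))))
      where

      open Expansions e (μ q d) ≡.refl ^-μ≤ <^-suc-μ
      open Division f n deg-f using (_rem; rem-deg; rem-mod; deg<∧mod⇒≈)
      open SemiringDivisibility semiring using (_∣_)
      open SemiringDivisibility (CommutativeRing.semiring (𝔸 / (P ^ e))) using () renaming (_∣_ to _∣ᵉ_)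
      open MonoidSum +-monoid using (sum)

      private
        σ̂ : Carrier → Carrier
        σ̂ h = σ ⟨$⟩ h

      BExpansion : Vector Carrier (q ℕ.^ n) → Carrier → Carrier
      BExpansion a h = sum λ k → a k * (B f n deg-f e (toℕ k) ⟨$⟩ h)

      rem-fixed : ∀ {h} → deg h < n → h rem ≈ h
      rem-fixed {h} deg-h = deg<∧mod⇒≈ (rem-deg h) deg-h (mod-sym (rem-mod h))

      -- `B` evaluates `Q k` at the remainder modulo `f`, and `Q k` need not be periodic modulo `f`;
      -- a representative of degree less than `n` is its own remainder.
      BExpansion≈combination : ∀ a {h} → deg h < n → BExpansion a h ≈ combination a h [mod P ^ e ]
      BExpansion≈combination a {h} deg-h = weighted-sum-cong a
        (λ k → B f n deg-f e (toℕ k) ⟨$⟩ h) (λ k → Qᵉ e (toℕ k) h)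
        λ k → Qᵉ-resp-≈ e {h rem} {h} (toℕ k) (rem-fixed {h} deg-h)

      Expands : Vector Carrier (q ℕ.^ n) → Set (c ⊔ ℓ₁)
      Expands a = ∀ h → σ̂ h ≈ BExpansion a h [mod P ^ e ]

      ExpandsAtPoints : Vector Carrier (q ℕ.^ n) → Set (c ⊔ ℓ₁)
      ExpandsAtPoints a = ∀ (j : Fin (q ℕ.^ n)) → σ̂ (b (toℕ j)) ≈ combination a (b (toℕ j)) [mod P ^ e ]

      point-deg : ∀ (j : Fin (q ℕ.^ n)) → deg (b (toℕ j)) < n
      point-deg j = b-deg n (toℕ j) (Fin.toℕ<n j)

      expands⇒ : ∀ a → Expands a → ExpandsAtPoints a
      expands⇒ a expands j = mod-trans (expands (b (toℕ j))) (BExpansion≈combination a (point-deg j))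

      -- Every class modulo `f` contains one of the first q^n nodes, and both sides depend only on
      -- the class.
      ⇒expands : ∀ a → ExpandsAtPoints a → Expands a
      ⇒expands a expands h with b-surjective n (h rem) (rem-deg h)
      ... | j , bⱼ≈ = mod-trans (Func.cong σ h≈bⱼ) (mod-trans (expands j)
        (mod-trans (mod-sym (BExpansion≈combination a (point-deg j)))
          (weighted-sum-cong a (λ k → B f n deg-f e (toℕ k) ⟨$⟩ b (toℕ j)) (λ k → B f n deg-f e (toℕ k) ⟨$⟩ h)
            λ k → Func.cong (B f n deg-f e (toℕ k)) (mod-sym h≈bⱼ))))
        where
        h≈bⱼ : h ≈ b (toℕ j) [mod f ]
        h≈bⱼ = mod-trans (rem-mod h) (≈⇒mod (sym bⱼ≈))

      DivisibleCoefficients : Vector Carrier (q ℕ.^ n) → Set (c ⊔ ℓ₁)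
      DivisibleCoefficients a = ∀ k → 1 ≤ toℕ k → (P ^ μ q d (toℕ k)) ∣ᵉ a k

      preserving⇒divisible : ∀ a → ExpandsAtPoints a → CongruencePreserving f n deg-f (P ^ e) σ →
        DivisibleCoefficients a
      preserving⇒divisible a expands preserving k _ = ⇒P^-∣ᵉ e (μ q d (toℕ k)) (a k)
        (coefficients-divisible (λ j → σ̂ (b j)) a expands
        (λ i j t i< j< t≤e → preserving (b i) (b j) (b-deg n i i<) (b-deg n j j<) (P ^ t) (P^-∣ {t} {e} t≤e)) k)

      divisible⇒preserving : ∀ a → Expands a → DivisibleCoefficients a →
        CongruencePreserving f n deg-f (P ^ e) σ
      -- `h` and some `P ^ i` divide each other, so they define the same congruence.
      divisible⇒preserving a expands divisible h₁ h₂ deg-h₁ deg-h₂ h h∣Pᵉ h₁≈h₂ with divisor-of-P^ e h∣Pᵉ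
      ... | i , i≤e , h∣Pⁱ , Pⁱ∣h = mod-∣ h∣Pⁱ
        (mod-trans (mod-∣ (P^-∣ {i} {e} i≤e) (at-representative deg-h₁))
          (mod-trans (combination-cong a a≈0 i i≤e (mod-∣ Pⁱ∣h h₁≈h₂))
            (mod-∣ (P^-∣ {i} {e} i≤e) (mod-sym (at-representative deg-h₂)))))
        where
        at-representative : ∀ {h} → deg h < n → σ̂ h ≈ combination a h [mod P ^ e ]
        at-representative {h} deg-h = mod-trans (expands h) (BExpansion≈combination a deg-h)
        a≈0 : ∀ k → a k ≈ 0# [mod P ^ (μ q d (toℕ k) ℕ.⊓ e) ]
        a≈0 k with toℕ k | divisible k
        -- The coefficient of index 0 is unrestricted; since μ(0) = 0 the claim is modulo 1.
        ... | zero  | _         = mod-1 (a k) 0#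
        ... | suc j | Pˢ∣aₖ = P^-∣ᵉ⇒ e (μ q d (suc j)) (a k) (Pˢ∣aₖ (s≤s z≤n))

      UniquelyExpands : (Vector Carrier (q ℕ.^ n) → Set (c ⊔ ℓ₁)) → Set (c ⊔ ℓ₁)
      UniquelyExpands = ∃! λ (a a′ : Vector Carrier (q ℕ.^ n)) → ∀ k → a k ≈ a′ k [mod P ^ e ]

      pointExpansion : UniquelyExpands ExpandsAtPoints
      pointExpansion = interpolation-∃! (q ℕ.^ n) λ j → σ̂ (b j)

      preserving⇒expansion : CongruencePreserving f n deg-f (P ^ e) σ →
        UniquelyExpands λ a → Expands a × DivisibleCoefficients a
      preserving⇒expansion preserving = extend-unique pointExpansion
        where
        extend-unique : UniquelyExpands ExpandsAtPoints →
          UniquelyExpands λ a → Expands a × DivisibleCoefficients a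
        extend-unique (a , expands , unique) =
          a , (⇒expands a expands , preserving⇒divisible a expands preserving) ,
          -- Uniqueness among all expansions passes to those with divisible coefficients.
          λ {a′} expands′ → unique {a′} (expands⇒ a′ (proj₁ expands′))

      expansion⇒preserving : UniquelyExpands (λ a → Expands a × DivisibleCoefficients a) →
        CongruencePreserving f n deg-f (P ^ e) σ
      expansion⇒preserving (a , (expands , divisible) , _) = divisible⇒preserving a expands divisible

theorem1p11 :
    ∀ {c ℓ₁ ℓ₂ : Level} (q : ℕ) → IsPrimePower q →
    (F : HeytingField c ℓ₁ ℓ₂)
    (enumeration : Inverse (CommutativeRing.setoid (fieldRing F)) (≡.setoid (Fin q))) →
    let open FiniteField F q enumeration in
    (f : CommutativeRing.Carrier 𝔸) (n : ℕ) (deg-f : deg f ≡ n) → 1 ≤ n →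
    (P : CommutativeRing.Carrier 𝔸) (d : ℕ) (deg-P : deg P ≡ d) (1≤d : 1 ≤ d) →
    (irreducible : Irreducible P) →
    (e : ℕ) → 1 ≤ e →
    (ordering : Ordering d) →
    let open Wagner P d deg-P 1≤d irreducible ordering
        open CommutativeRing (𝔸 / (P ^ e))
        open MonoidSum +-monoid
        open SemiringDivisibility semiring
        open VectorEquality setoid
    in
    (σ : Func (CommutativeRing.setoid (𝔸 / f)) setoid) →
    CongruencePreserving f n deg-f (P ^ e) σ ⇔
    ∃! _≋_ (λ (coefficients : Vector Carrier (q ℕ.^ n)) →
      (∀ h → (σ ⟨$⟩ h) ≈ sum (λ k → coefficients k * (B f n deg-f e (toℕ k) ⟨$⟩ h))) ×
      (∀ k → 1 ≤ toℕ k → (P ^ μ q d (toℕ k)) ∣ coefficients k))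
theorem1p11 q _ F enumeration f n deg-f _ P d deg-P 1≤d irreducible e _ ordering σ = mk⇔
  (preserving⇒expansion P d deg-P 1≤d irreducible ordering f n deg-f e σ)
  (expansion⇒preserving P d deg-P 1≤d irreducible ordering f n deg-f e σ)
  where open Interpolation q F enumeration
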